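{- For every (Borel) measure $\mu$ on $\mathbb R$, writing again $\mu$ for the continuous valuation it induces by restriction to the open subsets of $\mathbb R$, the image valuation $i[\mu]$ is a minimal valuation on $\mathbf I\mathbb R$ (resp., on $\mathbf I\mathbb R_\bot$).
   Context: $\overline{\mathbb R}_+=[0,+\infty]$. $\mathbf I\mathbb R$ is the dcpo of closed intervals $[a,b]$ with $a,b\in\mathbb R$, $a\le b$, ordered by reverse inclusion $\supseteq$; $\mathbf I\mathbb R_\bot$ is $\mathbf I\mathbb R$ with a fresh least element $\bot$ added. Both have their Scott topology. The map $i\colon a\mapsto[a,a]$ is a topological embedding of $\mathbb R$ (standard topology) into $\mathbf I\mathbb R$, resp. $\mathbf I\mathbb R_\bot$. A continuous valuation on a space $X$ is a Scott-continuous map $\nu\colon\mathcal O X\to\overline{\mathbb R}_+$ on the lattice of open sets with $\nu(\emptyset)=0$ and $\nu(U\cup V)+\nu(U\cap V)=\nu(U)+\nu(V)$; $\mathbf V X$ is the dcpo of continuous valuations on $X$, ordered pointwise. The image valuation is $f[\mu](V)=\mu(f^{ -1}(V))$. Measures take values in $\overline{\mathbb R}_+$ (no finiteness assumption); since $\mathbb R$ is second-countable, every Borel measure on $\mathbb R$ restricts to a continuous valuation. A simple valuation is a finite linear combination $\sum_{i=1}^n r_i\delta_{x_i}$ of Dirac valuations with $r_i\in\mathbb R_+$. The minimal valuations on $X$ are the elements of the smallest subset $\mathbf V_m X$ of $\mathbf V X$ containing all simple valuations and closed under directed suprema taken in $\mathbf V X$. -}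

module Defs where

open import Axiom.ExcludedMiddle using (ExcludedMiddle)
open import Data.Empty using (⊥-elim) renaming (⊥ to 𝟘)
open import Data.Integer.Base using (ℤ; +_; -[1+_]; _⊖_)
open import Data.List.Base using (List; []; _∷_)
open import Data.Nat.Base as ℕ using (ℕ; zero; suc)
import Data.Nat.Properties as ℕₚ
open import Data.Product.Base using (Σ; Σ-syntax; ∃; ∃-syntax; _×_; _,_; proj₁; proj₂)
open import Data.Rational.Base as ℚ using (ℚ; 0ℚ; 1ℚ)
import Data.Rational.Properties as ℚₚ
open import Data.Rational.Solver using (module +-*-Solver)
open import Data.Sum.Base using (_⊎_; inj₁; inj₂)
open import Data.Unit.Base using (tt)
open import Function.Base using (_∘_; id)
open import Level using (Level; 0ℓ; _⊔_; Lift; lift) renaming (suc to lsuc; lower to unlift)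
open import Relation.Binary.Bundles using (Poset)
import Relation.Binary.Construct.Add.Infimum.NonStrict as AddInfimum
import Relation.Binary.Construct.Interior.Symmetric as Interior
import Relation.Binary.Reasoning.Setoid as SetoidReasoning
open import Relation.Binary.Construct.Interior.Symmetric using (SymInterior; _,_; lhs≤rhs; rhs≤lhs)
open import Relation.Binary.Definitions using (tri<; tri≈; tri>)
open import Relation.Binary.PropositionalEquality.Core using (_≡_; _≢_; refl; sym; trans; cong; subst; cong₂)
open import Relation.Nullary.Construct.Add.Infimum using (_₋; ⊥₋; [_])
open import Relation.Nullary.Decidable.Core using (Dec; yes; no; True; toWitness; fromWitness; decidable-stable)
open import Relation.Nullary.Negation.Core using (¬_)
open import Relation.Unary using (Pred; _∈_; _∉_; _⊆_; _≐_; _∪_; _∩_; _∖_; ∁; ⋃; _⊢_; _⊥_; ∅; U; Satisfiable)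

1ℓ : Level
1ℓ = lsuc 0ℓ

-- The mathematics is classical: excluded middle is an explicit hypothesis
-- wherever it is needed.  Under it, a predicate at any level is equivalent to
-- one valued in Set, so `Subset A` is the full power set of A, and all
-- "arbitrary" subsets and families below are taken from it.

Subset : ∀ {a} → Set a → Set (a ⊔ 1ℓ)
Subset A = Pred A 0ℓ

module _ (em : ExcludedMiddle 1ℓ) where

  record Small (P : Set₁) : Set where
    constructor fromTrue
    field holds : True (em {P})

  small : ∀ {P} → P → Small P
  small p = fromTrue (fromWitness p)

  unsmall : ∀ {P} → Small P → P
  unsmall (fromTrue t) = toWitness t

  em₀ : ExcludedMiddle 0ℓ
  em₀ {P} with em {Lift 1ℓ P}
  ... | yes p = yes (unlift p)
  ... | no ¬p = no (λ p → ¬p (lift p))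

module _ {c ℓ₁ ℓ₂} (P : Poset c ℓ₁ ℓ₂) where
  open Poset P using (Carrier; _≤_)

  Directed : ∀ {ℓ} → Pred Carrier ℓ → Set (c ⊔ ℓ₂ ⊔ ℓ)
  Directed D = Satisfiable D ×
    (∀ {x y} → x ∈ D → y ∈ D → ∃[ z ] z ∈ D × x ≤ z × y ≤ z)

  IsSup : ∀ {ℓ} → Pred Carrier ℓ → Carrier → Set (c ⊔ ℓ₂ ⊔ ℓ)
  IsSup D s = (∀ {x} → x ∈ D → x ≤ s) × (∀ {z} → (∀ {x} → x ∈ D → x ≤ z) → s ≤ z)

  IsScottOpen : Subset Carrier → Set (c ⊔ ℓ₂ ⊔ 1ℓ)
  IsScottOpen V =
    (∀ {x y} → x ≤ y → x ∈ V → y ∈ V) ×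
    (∀ (D : Subset Carrier) → Directed D → ∀ {s} → IsSup D s → s ∈ V →
     ∃[ d ] d ∈ D × d ∈ V)

module _ {c ℓ₁ ℓ₂ c′ ℓ₁′ ℓ₂′} (P : Poset c ℓ₁ ℓ₂) (Q : Poset c′ ℓ₁′ ℓ₂′) where
  private
    module P = Poset P
    module Q = Poset Q

  directImage : ∀ {ℓ} → (P.Carrier → Q.Carrier) → Pred P.Carrier ℓ → Pred Q.Carrier (c ⊔ c′ ⊔ ℓ)
  directImage f D y = ∃[ x ] x ∈ D × y ≡ f x

  IsScottContinuous : (P.Carrier → Q.Carrier) → Set (c ⊔ ℓ₂ ⊔ c′ ⊔ ℓ₂′ ⊔ 1ℓ)
  IsScottContinuous f =
    (∀ {x y} → x P.≤ y → f x Q.≤ f y) ×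
    (∀ (D : Subset P.Carrier) → Directed P D → ∀ {s} → IsSup P D s →
     IsSup Q (directImage f D) (f s))

record Space : Set₂ where
  field
    Carrier : Set₁
    IsOpen  : Pred (Subset Carrier) 1ℓ
    open-U  : IsOpen U
    open-∩  : ∀ {V W} → IsOpen V → IsOpen W → IsOpen (V ∩ W)
    -- The union of the family 𝒱 is not formed but described, because the
    -- predicate ∃[ V ] V ∈ 𝒱 × x ∈ V does not land in Set.
    open-⋃  : (𝒱 : Pred (Subset Carrier) 1ℓ) → (∀ {V} → V ∈ 𝒱 → IsOpen V) →
              ∀ {W} → (∀ {V} → V ∈ 𝒱 → V ⊆ W) →
              (∀ {x} → x ∈ W → ∃[ V ] V ∈ 𝒱 × x ∈ V) → IsOpen W

  open-∅ : IsOpen ∅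
  open-∅ = open-⋃ (λ _ → Lift 1ℓ 𝟘) (λ ()) (λ ()) (λ ())

  open-∪ : ∀ {V W} → IsOpen V → IsOpen W → IsOpen (V ∪ W)
  open-∪ {V} {W} v w = open-⋃ (λ T → T ≡ V ⊎ T ≡ W)
    (λ { (inj₁ refl) → v ; (inj₂ refl) → w })
    (λ { (inj₁ refl) → inj₁ ; (inj₂ refl) → inj₂ })
    (λ { (inj₁ p) → V , inj₁ refl , p ; (inj₂ p) → W , inj₂ refl , p })

open Space using (IsOpen) renaming (Carrier to ∣_∣)

IsContinuous : (X Y : Space) → (∣ X ∣ → ∣ Y ∣) → Set₁
IsContinuous X Y f = ∀ (V : Subset ∣ Y ∣) → IsOpen Y V → IsOpen X (f ⊢ V)

record 𝒪 (X : Space) : Set₁ where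
  constructor ⟨_,_⟩
  field
    set    : Subset ∣ X ∣
    isOpen : IsOpen X set

open 𝒪 public

𝒪-poset : Space → Poset 1ℓ 1ℓ 1ℓ
𝒪-poset X = Interior.poset {R = λ (V W : 𝒪 X) → set V ⊆ set W} id (λ f g → g ∘ f)

module _ {X : Space} where
  open Space X using (open-∅; open-∩; open-∪)

  ∅ᵒ : 𝒪 X
  ∅ᵒ = ⟨ ∅ , open-∅ ⟩

  infixr 7 _∩ᵒ_
  infixr 6 _∪ᵒ_

  _∩ᵒ_ _∪ᵒ_ : 𝒪 X → 𝒪 X → 𝒪 X
  V ∩ᵒ W = ⟨ set V ∩ set W , open-∩ (isOpen V) (isOpen W) ⟩
  V ∪ᵒ W = ⟨ set V ∪ set W , open-∪ (isOpen V) (isOpen W) ⟩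

preimageᵒ : ∀ {X Y f} → IsContinuous X Y f → 𝒪 Y → 𝒪 X
preimageᵒ {f = f} f-cont V = ⟨ f ⊢ set V , f-cont (set V) (isOpen V) ⟩

scottSpace : Poset 1ℓ 1ℓ 1ℓ → Space
scottSpace P = record
  { Carrier = Carrier
  ; IsOpen  = IsScottOpen P
  ; open-U  = _ , λ D D-dir _ _ → proj₁ (proj₁ D-dir) , proj₂ (proj₁ D-dir) , tt
  ; open-∩  = λ (V↑ , V-acc) (W↑ , W-acc) →
      (λ x≤y (p , q) → V↑ x≤y p , W↑ x≤y q) ,
      λ D D-dir s-sup (p , q) →
        let (d , d∈D , d∈V) = V-acc D D-dir s-sup p
            (e , e∈D , e∈W) = W-acc D D-dir s-sup q
            (z , z∈D , d≤z , e≤z) = proj₂ D-dir d∈D e∈D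
        in z , z∈D , V↑ d≤z d∈V , W↑ e≤z e∈W
  ; open-⋃  = λ 𝒱 𝒱-open ⊆W W⊆ →
      (λ x≤y x∈W → let (V , V∈𝒱 , x∈V) = W⊆ x∈W
                   in ⊆W V∈𝒱 (proj₁ (𝒱-open V∈𝒱) x≤y x∈V)) ,
      λ D D-dir s-sup s∈W →
        let (V , V∈𝒱 , s∈V) = W⊆ s∈W
            (d , d∈D , d∈V) = proj₂ (𝒱-open V∈𝒱) D D-dir s-sup s∈V
        in d , d∈D , ⊆W V∈𝒱 d∈V
  } where open Poset P using (Carrier)

-- x ∈ [0,+∞] is given by the set of rationals q < x.  All negative rationals
-- belong to it, and +∞ is the cut containing every rational.

record ℝ̄₊ : Set₁ where
  field
    below    : Subset ℚ
    negative : ∀ {q} → q ℚ.< 0ℚ → q ∈ below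
    downward : ∀ {p q} → p ℚ.< q → q ∈ below → p ∈ below
    rounded  : ∀ {q} → q ∈ below → ∃[ r ] q ℚ.< r × r ∈ below

open ℝ̄₊ public

infix 4 _≤⁺_ _≈⁺_
infixl 6 _+⁺_

_≤⁺_ _≈⁺_ : ℝ̄₊ → ℝ̄₊ → Set
x ≤⁺ y = below x ⊆ below y
_≈⁺_ = SymInterior _≤⁺_

ℝ̄₊-poset : Poset 1ℓ 0ℓ 0ℓ
ℝ̄₊-poset = Interior.poset {R = _≤⁺_} id (λ f g → g ∘ f)

IsFinite : ℝ̄₊ → Set
IsFinite x = ∃[ q ] q ∉ below x

0⁺ : ℝ̄₊
0⁺ = record
  { below    = ℚ._< 0ℚ
  ; negative = id
  ; downward = ℚₚ.<-trans
  ; rounded  = ℚₚ.<-dense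
  }

p-q+q≡p : ∀ p q → (p ℚ.- q) ℚ.+ q ≡ p
p-q+q≡p = solve 2 (λ p q → (p :- q) :+ q := p) refl
  where open +-*-Solver

p+q-q≡p : ∀ p q → (p ℚ.+ q) ℚ.- q ≡ p
p+q-q≡p = solve 2 (λ p q → (p :+ q) :- q := p) refl
  where open +-*-Solver

<-sub : ∀ {p q} r → p ℚ.< q → p ℚ.- r ℚ.< q ℚ.- r
<-sub r p<q = ℚₚ.+-monoˡ-< (ℚ.- r) p<q

_+⁺_ : ℝ̄₊ → ℝ̄₊ → ℝ̄₊
x +⁺ y = record
  { below    = λ r → ∃[ p ] ∃[ q ] p ∈ below x × q ∈ below y × r ≡ p ℚ.+ q
  ; negative = λ {r} r<0 → let (s , r<s , s<0) = ℚₚ.<-dense r<0 in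
      r ℚ.- s , s ,
      negative x (subst (r ℚ.- s ℚ.<_) (ℚₚ.+-inverseʳ s) (<-sub s r<s)) ,
      negative y s<0 , sym (p-q+q≡p r s)
  ; downward = λ { {r} r<p+q (p , q , p∈x , q∈y , refl) →
      r ℚ.- q , q ,
      downward x (subst (r ℚ.- q ℚ.<_) (p+q-q≡p p q) (<-sub q r<p+q)) p∈x ,
      q∈y , sym (p-q+q≡p r q) }
  ; rounded  = λ { (p , q , p∈x , q∈y , refl) →
      let (p′ , p<p′ , p′∈x) = rounded x p∈x in
      p′ ℚ.+ q , ℚₚ.+-monoˡ-< q p<p′ , p′ , q , p′∈x , q∈y , refl }
  }

module ≈⁺-Reasoning = SetoidReasoning (Poset.Eq.setoid ℝ̄₊-poset)

+⁺-mono : ∀ x x′ y y′ → x ≤⁺ x′ → y ≤⁺ y′ → x +⁺ y ≤⁺ x′ +⁺ y′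
+⁺-mono _ _ _ _ f g (p , q , p∈ , q∈ , eq) = p , q , f p∈ , g q∈ , eq

+⁺-cong : ∀ x x′ y y′ → x ≈⁺ x′ → y ≈⁺ y′ → x +⁺ y ≈⁺ x′ +⁺ y′
+⁺-cong x x′ y y′ (f , f′) (g , g′) = +⁺-mono x x′ y y′ f g , +⁺-mono x′ x y′ y f′ g′

+⁺-comm : ∀ x y → x +⁺ y ≈⁺ y +⁺ x
+⁺-comm x y = swap , swap
  where
  swap : ∀ {P Q : Subset ℚ} {r} → ∃[ p ] ∃[ q ] p ∈ P × q ∈ Q × r ≡ p ℚ.+ q →
         ∃[ q ] ∃[ p ] q ∈ Q × p ∈ P × r ≡ q ℚ.+ p
  swap (p , q , p∈ , q∈ , eq) = q , p , q∈ , p∈ , trans eq (ℚₚ.+-comm p q)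

+⁺-assoc : ∀ x y z → (x +⁺ y) +⁺ z ≈⁺ x +⁺ (y +⁺ z)
+⁺-assoc x y z =
  (λ { (_ , r , (p , q , p∈ , q∈ , refl) , r∈ , refl) →
       p , q ℚ.+ r , p∈ , (q , r , q∈ , r∈ , refl) , ℚₚ.+-assoc p q r }) ,
  (λ { (p , _ , p∈ , (q , r , q∈ , r∈ , refl) , refl) →
       p ℚ.+ q , r , (p , q , p∈ , q∈ , refl) , r∈ , sym (ℚₚ.+-assoc p q r) })

+⁺-identityʳ : ∀ x → x +⁺ 0⁺ ≈⁺ x
+⁺-identityʳ x =
  (λ { (p , q , p∈ , q<0 , refl) →
       downward x (subst (p ℚ.+ q ℚ.<_) (ℚₚ.+-identityʳ p) (ℚₚ.+-monoʳ-< p q<0)) p∈ }) ,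
  (λ {q} q∈ → let (r , q<r , r∈) = rounded x q∈ in
     r , q ℚ.- r , r∈ , subst (q ℚ.- r ℚ.<_) (ℚₚ.+-inverseʳ r) (<-sub r q<r) ,
     sym (trans (ℚₚ.+-comm r (q ℚ.- r)) (p-q+q≡p q r)))

+⁺-identityˡ : ∀ x → 0⁺ +⁺ x ≈⁺ x
+⁺-identityˡ x = begin
  0⁺ +⁺ x ≈⟨ +⁺-comm 0⁺ x ⟩
  x +⁺ 0⁺ ≈⟨ +⁺-identityʳ x ⟩
  x       ∎
  where open ≈⁺-Reasoning

partialSum : (ℕ → ℝ̄₊) → ℕ → ℝ̄₊
partialSum a zero    = 0⁺
partialSum a (suc n) = partialSum a n +⁺ a n

series : (ℕ → ℝ̄₊) → ℝ̄₊
series a = record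
  { below    = λ q → ∃[ n ] q ∈ below (partialSum a n)
  ; negative = λ q<0 → 0 , q<0
  ; downward = λ p<q (n , q∈) → n , downward (partialSum a n) p<q q∈
  ; rounded  = λ (n , q∈) → let (r , q<r , r∈) = rounded (partialSum a n) q∈
                            in r , q<r , n , r∈
  }

-- r if the proposition holds, 0 otherwise
_when_ : ℝ̄₊ → Set → ℝ̄₊
r when A = record
  { below    = λ q → q ℚ.< 0ℚ ⊎ (A × q ∈ below r)
  ; negative = inj₁
  ; downward = λ { p<q (inj₁ q<0) → inj₁ (ℚₚ.<-trans p<q q<0)
                 ; p<q (inj₂ (a , q∈r)) → inj₂ (a , downward r p<q q∈r) }
  ; rounded  = λ { (inj₁ q<0) → let (s , q<s , s<0) = ℚₚ.<-dense q<0
                                in s , q<s , inj₁ s<0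
                 ; (inj₂ (a , q∈r)) → let (s , q<s , s∈r) = rounded r q∈r
                                      in s , q<s , inj₂ (a , s∈r) }
  }

record 𝐕 (X : Space) : Set₁ where
  field
    value           : 𝒪 X → ℝ̄₊
    scottContinuous : IsScottContinuous (𝒪-poset X) ℝ̄₊-poset value
    strict          : value ∅ᵒ ≈⁺ 0⁺
    modular         : ∀ V W → value (V ∪ᵒ W) +⁺ value (V ∩ᵒ W) ≈⁺ value V +⁺ value W

open 𝐕 public

𝐕-poset : Space → Poset 1ℓ 1ℓ 1ℓ
𝐕-poset X = Interior.poset {R = λ (μ ν : 𝐕 X) → ∀ V → value μ V ≤⁺ value ν V}
  (λ _ → id) (λ f g V → g V ∘ f V)

ℝ₊ : Set₁
ℝ₊ = Σ ℝ̄₊ IsFinite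

-- the value of Σᵢ rᵢ δ_{xᵢ} on V, where δₓ(V) is 1 if x ∈ V and 0 otherwise
diracSum : ∀ {X} → List (ℝ₊ × ∣ X ∣) → 𝒪 X → ℝ̄₊
diracSum []                   V = 0⁺
diracSum (((r , _) , x) ∷ rxs) V = (r when (x ∈ set V)) +⁺ diracSum rxs V

IsSimple : ∀ {X} → 𝐕 X → Set₁
IsSimple {X} ν = ∃[ rxs ] ∀ V → value ν V ≈⁺ diracSum {X} rxs V

-- As an inductive family this is the smallest subset of 𝐕 X closed under the
-- two constructors.  Suprema are taken in 𝐕 X, and ν ranges over all of them,
-- so the subset is closed under equality of valuations.
data IsMinimal {X : Space} : 𝐕 X → Set₁ where
  simple      : ∀ {ν} → IsSimple ν → IsMinimal ν
  directedSup : ∀ (D : Subset (𝐕 X)) → Directed (𝐕-poset X) D →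
                (∀ {μ} → μ ∈ D → IsMinimal μ) →
                ∀ {ν} → IsSup (𝐕-poset X) D ν → IsMinimal ν

module _ (em : ExcludedMiddle 1ℓ) where

  sup-isUnion : ∀ {X} (D : Subset (𝒪 X)) {W} → IsSup (𝒪-poset X) D W →
                ∀ {x} → x ∈ set W → ∃[ V ] V ∈ D × x ∈ set V
  sup-isUnion {X} D (_ , least) x∈W = unsmall em (least {union} (λ V∈D x∈V → small em (_ , V∈D , x∈V)) x∈W)
    where
    union : 𝒪 X
    union = ⟨ (λ x → Small em (∃[ V ] V ∈ D × x ∈ set V))
            , Space.open-⋃ X (λ T → ∃[ V ] V ∈ D × T ≡ set V)
                (λ { (V , _ , refl) → isOpen V })
                (λ { (V , V∈D , refl) x∈V → small em (V , V∈D , x∈V) })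
                (λ x∈ → let (V , V∈D , x∈V) = unsmall em x∈
                        in set V , (V , V∈D , refl) , x∈V) ⟩

  image : ∀ {X Y} (f : ∣ X ∣ → ∣ Y ∣) → IsContinuous X Y f → 𝐕 X → 𝐕 Y
  image {X} {Y} f f-cont ν = record
    { value           = νf
    ; scottContinuous = mono , sup
    ; strict          = lhs≤rhs-∅ , negative (νf ∅ᵒ)
    ; modular         = λ V W → begin
        νf (V ∪ᵒ W) +⁺ νf (V ∩ᵒ W)
          ≈⟨ +⁺-cong (νf (V ∪ᵒ W)) _ (νf (V ∩ᵒ W)) _
               (cong-ν {f⁻¹ (V ∪ᵒ W)} {f⁻¹ V ∪ᵒ f⁻¹ W} (id , id))
               (cong-ν {f⁻¹ (V ∩ᵒ W)} {f⁻¹ V ∩ᵒ f⁻¹ W} (id , id)) ⟩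
        value ν (f⁻¹ V ∪ᵒ f⁻¹ W) +⁺ value ν (f⁻¹ V ∩ᵒ f⁻¹ W)
          ≈⟨ modular ν (f⁻¹ V) (f⁻¹ W) ⟩
        νf V +⁺ νf W ∎
    }
    where
    open ≈⁺-Reasoning

    f⁻¹ : 𝒪 Y → 𝒪 X
    f⁻¹ = preimageᵒ {X} {Y} f-cont

    νf : 𝒪 Y → ℝ̄₊
    νf V = value ν (f⁻¹ V)

    mono-ν : ∀ {V W} → set V ⊆ set W → value ν V ≤⁺ value ν W
    mono-ν {V} {W} = proj₁ (scottContinuous ν) {V} {W}

    cong-ν : ∀ {V W} → set V ≐ set W → value ν V ≈⁺ value ν W
    cong-ν {V} {W} (V⊆W , W⊆V) = mono-ν {V} {W} V⊆W , mono-ν {W} {V} W⊆V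

    mono : ∀ {V W} → set V ⊆ set W → νf V ≤⁺ νf W
    mono {V} {W} V⊆W = mono-ν {f⁻¹ V} {f⁻¹ W} V⊆W

    lhs≤rhs-∅ : νf ∅ᵒ ≤⁺ 0⁺
    lhs≤rhs-∅ = lhs≤rhs (strict ν) ∘ mono-ν {f⁻¹ ∅ᵒ} {∅ᵒ} id

    sup : ∀ (D : Subset (𝒪 Y)) → Directed (𝒪-poset Y) D → ∀ {W} → IsSup (𝒪-poset Y) D W →
          IsSup ℝ̄₊-poset (directImage (𝒪-poset Y) ℝ̄₊-poset νf D) (νf W)
    sup D ((V₀ , V₀∈D) , D-dir) {W} W-sup =
      (λ { (V , V∈D , refl) → mono {V} {W} (proj₁ W-sup V∈D) }) ,
      λ {z} bound → proj₂ (proj₂ (scottContinuous ν) D′ D′-dir {f⁻¹ W} D′-sup) {z}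
        λ { (_ , V′∈D′ , refl) → let (V , V∈D , eq) = unsmall em V′∈D′ in
            subst (λ V′ → value ν V′ ≤⁺ z) (sym eq) (bound (V , V∈D , refl)) }
      where
      D′ : Subset (𝒪 X)
      D′ V′ = Small em (∃[ V ] V ∈ D × V′ ≡ f⁻¹ V)

      D′-dir : Directed (𝒪-poset X) D′
      D′-dir = (f⁻¹ V₀ , small em (V₀ , V₀∈D , refl)) , λ {x} {y} p q → go {x} {y} (unsmall em p) (unsmall em q)
        where
        go : ∀ {x y} → ∃[ V ] V ∈ D × x ≡ f⁻¹ V → ∃[ V ] V ∈ D × y ≡ f⁻¹ V →
             Σ[ z ∈ 𝒪 X ] z ∈ D′ × set x ⊆ set z × set y ⊆ set z
        go (V , V∈D , refl) (V′ , V′∈D , refl) =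
          let (T , T∈D , V⊆T , V′⊆T) = D-dir V∈D V′∈D in
          f⁻¹ T , small em (T , T∈D , refl) , (λ {_} p → V⊆T p) , λ {_} p → V′⊆T p

      D′-sup : IsSup (𝒪-poset X) D′ (f⁻¹ W)
      D′-sup = (λ V′∈D′ → upper (unsmall em V′∈D′)) ,
        λ bound x∈ → let (V , V∈D , fx∈V) = sup-isUnion {Y} D {W} W-sup x∈ in
                     bound {f⁻¹ V} (small em (V , V∈D , refl)) fx∈V
        where
        upper : ∀ {V′} → ∃[ V ] V ∈ D × V′ ≡ f⁻¹ V → set V′ ⊆ f ⊢ set W
        upper (V , V∈D , refl) p = proj₁ W-sup V∈D p

data IsBorel (X : Space) : Subset ∣ X ∣ → Set₁ where
  borel-open : ∀ {A} → IsOpen X A → IsBorel X A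
  borel-∁    : ∀ {A} → IsBorel X A → IsBorel X (∁ A)
  borel-⋃    : ∀ {A : ℕ → Subset ∣ X ∣} → (∀ n → IsBorel X (A n)) → IsBorel X (⋃ ℕ A)
  borel-resp : ∀ {A B} → A ≐ B → IsBorel X A → IsBorel X B

borel-∅ : ∀ {X} → IsBorel X ∅
borel-∅ {X} = borel-open (Space.open-∅ X)

record Measure (X : Space) : Set₁ where
  field
    measure     : ∀ A → IsBorel X A → ℝ̄₊
    -- subsets are compared extensionally; in particular the value does not
    -- depend on the proof of measurability
    measure-resp : ∀ {A B} (a : IsBorel X A) (b : IsBorel X B) → A ≐ B →
                   measure A a ≈⁺ measure B b
    measure-∅   : measure ∅ borel-∅ ≈⁺ 0⁺
    σ-additive  : (A : ℕ → Subset ∣ X ∣) (a : ∀ n → IsBorel X (A n)) →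
                  (∀ {m n} → m ≢ n → A m ⊥ A n) →
                  measure (⋃ ℕ A) (borel-⋃ a) ≈⁺ series (λ n → measure (A n) (a n))

open Measure public

module _ {X : Space} where

  seq : Subset ∣ X ∣ → Subset ∣ X ∣ → ℕ → Subset ∣ X ∣
  seq A B 0             = A
  seq A B 1             = B
  seq A B (suc (suc _)) = ∅

  seq-borel : ∀ {A B} → IsBorel X A → IsBorel X B → ∀ n → IsBorel X (seq A B n)
  seq-borel a b 0             = a
  seq-borel a b 1             = b
  seq-borel a b (suc (suc _)) = borel-∅

  seq-∪ : ∀ A B → ⋃ ℕ (seq A B) ≐ A ∪ B
  seq-∪ A B = (λ { (0 , x∈A) → inj₁ x∈A ; (1 , x∈B) → inj₂ x∈B }) ,
              (λ { (inj₁ x∈A) → 0 , x∈A ; (inj₂ x∈B) → 1 , x∈B })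

  borel-∪ : ∀ {A B} → IsBorel X A → IsBorel X B → IsBorel X (A ∪ B)
  borel-∪ {A} {B} a b = borel-resp (seq-∪ A B) (borel-⋃ (seq-borel a b))

  module _ (em : ExcludedMiddle 1ℓ) where

    borel-∩ : ∀ {A B} → IsBorel X A → IsBorel X B → IsBorel X (A ∩ B)
    borel-∩ {A} {B} a b = borel-resp deMorgan (borel-∁ (borel-∪ (borel-∁ a) (borel-∁ b)))
      where
      deMorgan : ∁ (∁ A ∪ ∁ B) ≐ A ∩ B
      deMorgan = (λ x∉ → decidable-stable (em₀ em) (x∉ ∘ inj₁) , decidable-stable (em₀ em) (x∉ ∘ inj₂)) ,
                 λ { (x∈A , x∈B) (inj₁ x∉A) → x∉A x∈A ; (x∈A , x∈B) (inj₂ x∉B) → x∉B x∈B }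

    borel-∖ : ∀ {A B} → IsBorel X A → IsBorel X B → IsBorel X (A ∖ B)
    borel-∖ a b = borel-∩ a (borel-∁ b)

  module _ (μ : Measure X) where

    measure-∪ : ∀ {A B C} (a : IsBorel X A) (b : IsBorel X B) (c : IsBorel X C) →
                C ≐ A ∪ B → A ⊥ B → measure μ C c ≈⁺ measure μ A a +⁺ measure μ B b
    measure-∪ {A} {B} {C} a b c (C⊆ , ⊆C) A⊥B = begin
      measure μ C c
        ≈⟨ measure-resp μ c (borel-⋃ s-borel) (proj₂ (seq-∪ A B) ∘ C⊆ , ⊆C ∘ proj₁ (seq-∪ A B)) ⟩
      measure μ (⋃ ℕ s) (borel-⋃ s-borel)
        ≈⟨ σ-additive μ s s-borel (λ {m} {n} → disjoint m n) ⟩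
      series m
        ≈⟨ (λ (n , q∈) → bound n q∈) , (λ q∈ → 2 , q∈) ⟩
      (0⁺ +⁺ m 0) +⁺ m 1
        ≈⟨ +⁺-cong (0⁺ +⁺ m 0) (m 0) (m 1) (m 1) (+⁺-identityˡ (m 0)) (id , id) ⟩
      measure μ A a +⁺ measure μ B b ∎
      where
      open ≈⁺-Reasoning

      s : ℕ → Subset ∣ X ∣
      s = seq A B

      s-borel : ∀ n → IsBorel X (s n)
      s-borel = seq-borel a b

      m : ℕ → ℝ̄₊
      m n = measure μ (s n) (s-borel n)

      disjoint : ∀ i j → i ≢ j → s i ⊥ s j
      disjoint 0 0 i≢j _ = i≢j refl
      disjoint 0 1 _ p = A⊥B p
      disjoint 0 (suc (suc _)) _ (_ , ())
      disjoint 1 0 _ (p , q) = A⊥B (q , p)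
      disjoint 1 1 i≢j _ = i≢j refl
      disjoint 1 (suc (suc _)) _ (_ , ())
      disjoint (suc (suc _)) _ _ (() , _)

      bound : ∀ n → partialSum m n ≤⁺ partialSum m 2
      bound 0 q∈ = negative (partialSum m 2) q∈
      bound 1 q∈ = +⁺-mono (partialSum m 1) (partialSum m 1) 0⁺ (m 1) id (negative (m 1))
                     (rhs≤lhs (+⁺-identityʳ (partialSum m 1)) q∈)
      bound 2 q∈ = q∈
      bound (suc (suc (suc n))) q∈ = bound (suc (suc n))
        (lhs≤rhs (+⁺-identityʳ (partialSum m (suc (suc n))))
          (+⁺-mono (partialSum m (suc (suc n))) (partialSum m (suc (suc n)))
             (m (suc (suc n))) 0⁺ id
             (lhs≤rhs (measure-∅ μ)) q∈))

    module _ (em : ExcludedMiddle 1ℓ) where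

      measure-mono : ∀ {A B} (a : IsBorel X A) (b : IsBorel X B) → A ⊆ B →
                     measure μ A a ≤⁺ measure μ B b
      measure-mono {A} {B} a b A⊆B =
        rhs≤lhs (measure-∪ a b∖a b
          ((λ x∈B → split x∈B (em₀ em)) , λ { (inj₁ x∈A) → A⊆B x∈A ; (inj₂ (x∈B , _)) → x∈B })
          (λ (x∈A , _ , x∉A) → x∉A x∈A))
        ∘ +⁺-mono (measure μ A a) (measure μ A a) 0⁺ (measure μ (B ∖ A) b∖a) id (negative (measure μ (B ∖ A) b∖a))
        ∘ rhs≤lhs (+⁺-identityʳ (measure μ A a))
        where
        b∖a : IsBorel X (B ∖ A)
        b∖a = borel-∖ em b a

        split : ∀ {x} → x ∈ B → Dec (x ∈ A) → x ∈ A ∪ (B ∖ A)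
        split x∈B (yes x∈A) = inj₁ x∈A
        split x∈B (no x∉A)  = inj₂ (x∈B , x∉A)

      measure-modular : ∀ {A B} (a : IsBorel X A) (b : IsBorel X B)
                        (a∪b : IsBorel X (A ∪ B)) (a∩b : IsBorel X (A ∩ B)) →
                        measure μ (A ∪ B) a∪b +⁺ measure μ (A ∩ B) a∩b ≈⁺ measure μ A a +⁺ measure μ B b
      measure-modular {A} {B} a b a∪b a∩b = begin
        measure μ (A ∪ B) a∪b +⁺ i
          ≈⟨ +⁺-cong _ (measure μ A a +⁺ d) i i
               (measure-∪ a b∖a a∪b
                 ((λ { (inj₁ x∈A) → inj₁ x∈A ; (inj₂ x∈B) → split x∈B (em₀ em) })
                 , λ { (inj₁ x∈A) → inj₁ x∈A ; (inj₂ (x∈B , _)) → inj₂ x∈B })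
                 (λ (x∈A , _ , x∉A) → x∉A x∈A))
               (id , id) ⟩
        (measure μ A a +⁺ d) +⁺ i
          ≈⟨ +⁺-assoc (measure μ A a) d i ⟩
        measure μ A a +⁺ (d +⁺ i)
          ≈⟨ +⁺-cong (measure μ A a) (measure μ A a) (d +⁺ i) (i +⁺ d) (id , id) (+⁺-comm d i) ⟩
        measure μ A a +⁺ (i +⁺ d)
          ≈⟨ +⁺-cong (measure μ A a) (measure μ A a) (measure μ B b) (i +⁺ d) (id , id)
               (measure-∪ a∩b b∖a b
                 ((λ x∈B → split′ x∈B (em₀ em)) , λ { (inj₁ (_ , x∈B)) → x∈B ; (inj₂ (x∈B , _)) → x∈B })
                 (λ ((x∈A , _) , _ , x∉A) → x∉A x∈A)) ⟨
        measure μ A a +⁺ measure μ B b ∎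
        where
        open ≈⁺-Reasoning

        b∖a : IsBorel X (B ∖ A)
        b∖a = borel-∖ em b a

        d i : ℝ̄₊
        d = measure μ (B ∖ A) b∖a
        i = measure μ (A ∩ B) a∩b

        split : ∀ {x} → x ∈ B → Dec (x ∈ A) → x ∈ A ∪ (B ∖ A)
        split x∈B (yes x∈A) = inj₁ x∈A
        split x∈B (no x∉A)  = inj₂ (x∈B , x∉A)

        split′ : ∀ {x} → x ∈ B → Dec (x ∈ A) → x ∈ (A ∩ B) ∪ (B ∖ A)
        split′ x∈B (yes x∈A) = inj₁ (x∈A , x∈B)
        split′ x∈B (no x∉A)  = inj₂ (x∈B , x∉A)

      module _ (B : ℕ → Subset ∣ X ∣) (b : ∀ n → IsBorel X (B n)) where

        initial : ℕ → Subset ∣ X ∣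
        initial zero    = ∅
        initial (suc n) = initial n ∪ B n

        initial-borel : ∀ n → IsBorel X (initial n)
        initial-borel zero    = borel-∅
        initial-borel (suc n) = borel-∪ (initial-borel n) (b n)

        measure-⋃-≤ : ∀ z → (∀ n → measure μ (initial n) (initial-borel n) ≤⁺ z) →
                      measure μ (⋃ ℕ B) (borel-⋃ b) ≤⁺ z
        measure-⋃-≤ z bound q∈ =
          let (n , q∈′) = lhs≤rhs (σ-additive μ C c (λ {m} {n} → disjoint m n))
                            (lhs≤rhs (measure-resp μ (borel-⋃ b) (borel-⋃ c) ⋃B≐⋃C) q∈)
          in bound n (rhs≤lhs (initial≈ n) q∈′)
          where
          C : ℕ → Subset ∣ X ∣
          C n = B n ∖ initial n

          c : ∀ n → IsBorel X (C n)
          c n = borel-∖ em (b n) (initial-borel n)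

          B⊆initial : ∀ {m n} → m ℕ.<′ n → B m ⊆ initial n
          B⊆initial ℕ.<′-base         x∈ = inj₂ x∈
          B⊆initial (ℕ.≤′-step m<n)   x∈ = inj₁ (B⊆initial m<n x∈)

          disjoint : ∀ m n → m ≢ n → C m ⊥ C n
          disjoint m n m≢n ((x∈Bm , x∉m) , (x∈Bn , x∉n)) with ℕₚ.<-cmp m n
          ... | tri< m<n _ _ = x∉n (B⊆initial (ℕₚ.<⇒<′ m<n) x∈Bm)
          ... | tri≈ _ m≡n _ = m≢n m≡n
          ... | tri> _ _ n<m = x∉m (B⊆initial (ℕₚ.<⇒<′ n<m) x∈Bn)

          split : ∀ n {x} → x ∈ B n → Dec (x ∈ initial n) → x ∈ initial n ∪ C n
          split n x∈B (yes x∈) = inj₁ x∈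
          split n x∈B (no x∉)  = inj₂ (x∈B , x∉)

          initial⊆⋃C : ∀ n → initial n ⊆ ⋃ ℕ C
          initial⊆⋃C (suc n) (inj₁ x∈) = initial⊆⋃C n x∈
          initial⊆⋃C (suc n) (inj₂ x∈B) with split n x∈B (em₀ em)
          ... | inj₁ x∈  = initial⊆⋃C n x∈
          ... | inj₂ x∈C = n , x∈C

          ⋃B≐⋃C : ⋃ ℕ B ≐ ⋃ ℕ C
          ⋃B≐⋃C = (λ (n , x∈B) → initial⊆⋃C (suc n) (inj₂ x∈B)) , λ (n , x∈B , _) → n , x∈B

          m : ℕ → ℝ̄₊
          m n = measure μ (C n) (c n)

          initial≈ : ∀ n → measure μ (initial n) (initial-borel n) ≈⁺ partialSum m n
          initial≈ zero    = measure-∅ μ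
          initial≈ (suc n) = begin
            measure μ (initial (suc n)) (initial-borel (suc n))
              ≈⟨ measure-∪ (initial-borel n) (c n) (initial-borel (suc n))
                   ((λ { (inj₁ x∈) → inj₁ x∈ ; (inj₂ x∈B) → split n x∈B (em₀ em) })
                   , λ { (inj₁ x∈) → inj₁ x∈ ; (inj₂ (x∈B , _)) → inj₂ x∈B })
                   (λ (x∈ , _ , x∉) → x∉ x∈) ⟩
            measure μ (initial n) (initial-borel n) +⁺ m n
              ≈⟨ +⁺-cong _ (partialSum m n) (m n) (m n) (initial≈ n) (id , id) ⟩
            partialSum m (suc n) ∎
            where open ≈⁺-Reasoning

record ℝ : Set₁ where
  field
    lower upper     : Subset ℚ
    lower-inhabited : Satisfiable lower
    upper-inhabited : Satisfiable upper
    lower-downward  : ∀ {p q} → p ℚ.< q → q ∈ lower → p ∈ lower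
    upper-upward    : ∀ {p q} → p ℚ.< q → p ∈ upper → q ∈ upper
    lower-rounded   : ∀ {p} → p ∈ lower → ∃[ q ] p ℚ.< q × q ∈ lower
    upper-rounded   : ∀ {q} → q ∈ upper → ∃[ p ] p ℚ.< q × p ∈ upper
    disjoint        : lower ⊥ upper
    located         : ∀ {p q} → p ℚ.< q → p ∈ lower ⊎ q ∈ upper

open ℝ public using (lower; upper)

infix 4 _≤ᴿ_

_≤ᴿ_ : ℝ → ℝ → Set
x ≤ᴿ y = lower x ⊆ lower y

fromℚ : ℚ → ℝ
fromℚ q = record
  { lower           = ℚ._< q
  ; upper           = q ℚ.<_
  ; lower-inhabited = q ℚ.- 1ℚ , subst (q ℚ.- 1ℚ ℚ.<_) (ℚₚ.+-identityʳ q) (ℚₚ.+-monoʳ-< q (ℚₚ.negative⁻¹ (ℚ.- 1ℚ)))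
  ; upper-inhabited = q ℚ.+ 1ℚ , subst (ℚ._< q ℚ.+ 1ℚ) (ℚₚ.+-identityʳ q) (ℚₚ.+-monoʳ-< q (ℚₚ.positive⁻¹ 1ℚ))
  ; lower-downward  = ℚₚ.<-trans
  ; upper-upward    = λ r<s q<r → ℚₚ.<-trans q<r r<s
  ; lower-rounded   = ℚₚ.<-dense
  ; upper-rounded   = λ q<s → let (r , q<r , r<s) = ℚₚ.<-dense q<s in r , r<s , q<r
  ; disjoint        = λ (p<q , q<p) → ℚₚ.<-asym p<q q<p
  ; located         = λ {r} r<s → compare r<s (r ℚₚ.<? q)
  }
  where
  compare : ∀ {r s} → r ℚ.< s → Dec (r ℚ.< q) → r ℚ.< q ⊎ q ℚ.< s
  compare r<s (yes r<q) = inj₁ r<q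
  compare r<s (no r≮q)  = inj₂ (ℚₚ.≤-<-trans (ℚₚ.≮⇒≥ r≮q) r<s)

module _ (x : ℝ) where
  open ℝ x hiding (lower; upper)

  lower-≤ : ∀ {p q} → p ℚ.≤ q → q ∈ lower x → p ∈ lower x
  lower-≤ p≤q q∈ = let (r , q<r , r∈) = lower-rounded q∈ in lower-downward (ℚₚ.≤-<-trans p≤q q<r) r∈

  upper-≤ : ∀ {p q} → p ℚ.≤ q → p ∈ upper x → q ∈ upper x
  upper-≤ p≤q p∈ = let (r , r<p , r∈) = upper-rounded p∈ in upper-upward (ℚₚ.<-≤-trans r<p p≤q) r∈

  lower-⊔ : ∀ {p q} → p ∈ lower x → q ∈ lower x → ∃[ r ] r ∈ lower x × p ℚ.≤ r × q ℚ.≤ r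
  lower-⊔ {p} {q} p∈ q∈ with ℚₚ.≤-total p q
  ... | inj₁ p≤q = q , q∈ , p≤q , ℚₚ.≤-refl
  ... | inj₂ q≤p = p , p∈ , ℚₚ.≤-refl , q≤p

  upper-⊓ : ∀ {p q} → p ∈ upper x → q ∈ upper x → ∃[ r ] r ∈ upper x × r ℚ.≤ p × r ℚ.≤ q
  upper-⊓ {p} {q} p∈ q∈ with ℚₚ.≤-total p q
  ... | inj₁ p≤q = p , p∈ , ℚₚ.≤-refl , p≤q
  ... | inj₂ q≤p = q , q∈ , q≤p , ℚₚ.≤-refl

  lower<upper : ∀ {p q} → p ∈ lower x → q ∈ upper x → p ℚ.< q
  lower<upper {p} {q} p∈ q∈ with p ℚₚ.<? q
  ... | yes p<q = p<q
  ... | no p≮q  = ⊥-elim (disjoint (p∈ , upper-≤ (ℚₚ.≮⇒≥ p≮q) q∈))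

⦅_,_⦆ : ℚ → ℚ → Subset ℝ
⦅ p , q ⦆ x = p ∈ lower x × q ∈ upper x

⦅⦆-mono : ∀ {p p′ q q′} → p ℚ.≤ p′ → q′ ℚ.≤ q → ⦅ p′ , q′ ⦆ ⊆ ⦅ p , q ⦆
⦅⦆-mono p≤ ≤q {x} (p′∈ , q′∈) = lower-≤ x p≤ p′∈ , upper-≤ x ≤q q′∈

IsOpenᴿ : Subset ℝ → Set₁
IsOpenᴿ V = ∀ {x} → x ∈ V → ∃[ p ] ∃[ q ] x ∈ ⦅ p , q ⦆ × ⦅ p , q ⦆ ⊆ V

ℝ-space : Space
ℝ-space = record
  { Carrier = ℝ
  ; IsOpen  = IsOpenᴿ
  ; open-U  = λ {x} _ → let (p , p∈) = ℝ.lower-inhabited x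
                            (q , q∈) = ℝ.upper-inhabited x
                        in p , q , (p∈ , q∈) , λ _ → tt
  ; open-∩  = λ v w {x} (x∈V , x∈W) →
      let (p , q , (p∈ , q∈) , ⊆V)     = v x∈V
          (p′ , q′ , (p′∈ , q′∈) , ⊆W) = w x∈W
          (r , r∈ , p≤r , p′≤r)        = lower-⊔ x p∈ p′∈
          (s , s∈ , s≤q , s≤q′)        = upper-⊓ x q∈ q′∈
      in r , s , (r∈ , s∈) , λ {y} y∈ → ⊆V (⦅⦆-mono p≤r s≤q {y} y∈) , ⊆W (⦅⦆-mono p′≤r s≤q′ {y} y∈)
  ; open-⋃  = λ 𝒱 𝒱-open ⊆W W⊆ x∈W →
      let (V , V∈𝒱 , x∈V)     = W⊆ x∈W
          (p , q , x∈ , ⊆V) = 𝒱-open V∈𝒱 x∈V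
      in p , q , x∈ , λ y∈ → ⊆W V∈𝒱 (⊆V y∈)
  }

⦅⦆-open : ∀ p q → IsOpenᴿ ⦅ p , q ⦆
⦅⦆-open p q {x} x∈ = p , q , x∈ , id

next : ℕ × ℕ → ℕ × ℕ
next (zero  , n) = suc n , zero
next (suc m , n) = m , suc n

unpair : ℕ → ℕ × ℕ
unpair zero    = zero , zero
unpair (suc k) = next (unpair k)

unpair-surjective : ∀ m n → ∃[ k ] unpair k ≡ (m , n)
unpair-surjective m n = reach (m ℕ.+ n) n m refl
  where
  reach : ∀ s n m → m ℕ.+ n ≡ s → ∃[ k ] unpair k ≡ (m , n)
  reach s (suc n) m eq =
    let (k , e) = reach s n (suc m) (trans (sym (ℕₚ.+-suc m n)) eq) in suc k , cong next e
  reach s zero zero eq = 0 , refl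
  reach (suc s) zero (suc m) eq =
    let (k , e) = reach s m zero (ℕₚ.suc-injective (trans (cong suc (sym (ℕₚ.+-identityʳ m))) eq))
    in suc k , cong next e

enumℚ : ℕ → ℚ
enumℚ k = let (i , d) = unpair k
              (m , n) = unpair i
          in (m ⊖ n) ℚ./ suc d

enumℚ-surjective : ∀ q → ∃[ k ] enumℚ k ≡ q
enumℚ-surjective q =
  let (m , n , e) = difference (ℚ.↥ q)
      (i , e′)    = unpair-surjective m n
      (k , e″)    = unpair-surjective i (ℚ.denominator-1 q)
  in k , trans (helper {k} e″ e′) (trans (cong (ℚ._/ ℚ.↧ₙ q) e) (ℚₚ.↥p/↧p≡p q))
  where
  difference : ∀ z → ∃[ m ] ∃[ n ] m ⊖ n ≡ z
  difference (+ m)      = m , 0 , refl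
  difference (-[1+ n ]) = 0 , suc n , refl

  helper : ∀ {k i d m n} → unpair k ≡ (i , d) → unpair i ≡ (m , n) →
           enumℚ k ≡ (m ⊖ n) ℚ./ suc d
  helper e e′ rewrite e | e′ = refl

enum⦅⦆ : ℕ → Subset ℝ
enum⦅⦆ k = let (i , j) = unpair k in ⦅ enumℚ i , enumℚ j ⦆

enum⦅⦆-surjective : ∀ p q → ∃[ k ] enum⦅⦆ k ≡ ⦅ p , q ⦆
enum⦅⦆-surjective p q =
  let (i , e)  = enumℚ-surjective p
      (j , e′) = enumℚ-surjective q
      (k , e″) = unpair-surjective i j
  in k , trans (cong (λ (i , j) → ⦅ enumℚ i , enumℚ j ⦆) e″) (cong₂ ⦅_,_⦆ e e′)

module _ (em : ExcludedMiddle 1ℓ) where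

  restrict : Measure ℝ-space → 𝐕 ℝ-space
  restrict μ = record
    { value           = ν
    ; scottContinuous = (λ {V} {W} → mono {V} {W}) , sup
    ; strict          = measure-∅ μ
    ; modular         = λ V W → measure-modular μ em (borel-open (isOpen V)) (borel-open (isOpen W)) _ _
    }
    where
    ν : 𝒪 ℝ-space → ℝ̄₊
    ν V = measure μ (set V) (borel-open (isOpen V))

    mono : ∀ {V W} → set V ⊆ set W → ν V ≤⁺ ν W
    mono {V} {W} = measure-mono μ em (borel-open (isOpen V)) (borel-open (isOpen W))

    sup : ∀ (D : Subset (𝒪 ℝ-space)) → Directed (𝒪-poset ℝ-space) D →
          ∀ {W} → IsSup (𝒪-poset ℝ-space) D W →
          IsSup ℝ̄₊-poset (directImage (𝒪-poset ℝ-space) ℝ̄₊-poset ν D) (ν W)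
    sup D ((V₀ , V₀∈D) , D-dir) {W} W-sup =
      (λ { (V , V∈D , refl) → mono {V} {W} (proj₁ W-sup V∈D) }) ,
      λ {z} bound →
        measure-⋃-≤ μ em B b z
          (λ n → let (V , V∈D , initial⊆V) = initial⊆ n in
                 bound (V , V∈D , refl) ∘
                 measure-mono μ em (initial-borel μ em B b n) (borel-open (isOpen V)) initial⊆V)
        ∘ measure-mono μ em (borel-open (isOpen W)) (borel-⋃ b) W⊆
      where
      Inside : ℕ → Set₁
      Inside k = ∃[ V ] V ∈ D × enum⦅⦆ k ⊆ set V

      B : ℕ → Subset ℝ
      B k x = Small em (Inside k) × x ∈ enum⦅⦆ k

      b : ∀ k → IsBorel ℝ-space (B k)
      b k = borel-open (λ (k-inside , x∈) → _ , _ , x∈ , λ y∈ → k-inside , y∈)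

      initial⊆ : ∀ n → ∃[ V ] V ∈ D × initial μ em B b n ⊆ set V
      initial⊆ zero = V₀ , V₀∈D , λ ()
      initial⊆ (suc n) with initial⊆ n | em {Inside n}
      ... | V , V∈D , ⊆V | no ¬inside = V , V∈D ,
        λ { (inj₁ x∈) → ⊆V x∈ ; (inj₂ (inside , _)) → ⊥-elim (¬inside (unsmall em inside)) }
      ... | V , V∈D , ⊆V | yes (V′ , V′∈D , ⊆V′) =
        let (T , T∈D , V⊆T , V′⊆T) = D-dir V∈D V′∈D in
        T , T∈D , λ { (inj₁ x∈) → V⊆T (⊆V x∈) ; (inj₂ (_ , x∈)) → V′⊆T (⊆V′ x∈) }

      W⊆ : set W ⊆ ⋃ ℕ B
      W⊆ {x} x∈W =
        let (V , V∈D , x∈V)   = sup-isUnion em {ℝ-space} D {W} W-sup x∈W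
            (p , q , x∈ , ⊆V) = isOpen V x∈V
            (k , e)           = enum⦅⦆-surjective p q
        in k , small em (V , V∈D , subst (_⊆ set V) (sym e) ⊆V) , subst (x ∈_) (sym e) x∈

record 𝐈ℝ : Set₁ where
  field
    left right : ℝ
    left≤right : left ≤ᴿ right

open 𝐈ℝ public using (left; right)

infix 4 _∈ᴵ_

_∈ᴵ_ : ℝ → 𝐈ℝ → Set
r ∈ᴵ I = left I ≤ᴿ r × r ≤ᴿ right I

𝐈ℝ-poset : Poset 1ℓ 1ℓ 1ℓ
𝐈ℝ-poset = Interior.poset {R = λ I J → ∀ {r} → r ∈ᴵ J → r ∈ᴵ I}
  (λ {I} {r} → id) (λ f g {r} → f {r} ∘ g {r})

addBottom : Poset 1ℓ 1ℓ 1ℓ → Poset 1ℓ 1ℓ 1ℓ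
addBottom P = record
  { Carrier        = Carrier ₋
  ; isPartialOrder = AddInfimum.≤₋-isPartialOrder _≤_ isPartialOrder
  } where open Poset P

𝐈ℝ-space 𝐈ℝ⊥-space : Space
𝐈ℝ-space  = scottSpace 𝐈ℝ-poset
𝐈ℝ⊥-space = scottSpace (addBottom 𝐈ℝ-poset)

i : ℝ → 𝐈ℝ
i a = record { left = a ; right = a ; left≤right = id }

i⊥ : ℝ → 𝐈ℝ ₋
i⊥ a = [ i a ]

[_,_]⟨_⟩ : ∀ p q → p ℚ.≤ q → 𝐈ℝ
[ p , q ]⟨ p≤q ⟩ = record
  { left = fromℚ p ; right = fromℚ q ; left≤right = λ r<p → ℚₚ.<-≤-trans r<p p≤q }

[]-continuous : ∀ P → IsContinuous (scottSpace P) (scottSpace (addBottom P)) [_]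
[]-continuous P V (V↑ , V-acc) = (λ x≤y → V↑ AddInfimum.[ x≤y ]) , acc
  where
  open Poset P using (Carrier; _≤_)

  acc : ∀ (D : Subset Carrier) → Directed P D → ∀ {s} → IsSup P D s → [ s ] ∈ V →
        ∃[ d ] d ∈ D × [ d ] ∈ V
  acc D ((d₀ , d₀∈D) , D-dir) {s} (upper-bound , least) s∈V
    with V-acc D₋ D₋-dir (D₋-upper-bound , D₋-least) s∈V
    where
    D₋ : Subset (Carrier ₋)
    D₋ ⊥₋    = 𝟘
    D₋ [ d ] = d ∈ D

    D₋-dir : Directed (addBottom P) D₋
    D₋-dir = ([ d₀ ] , d₀∈D) ,
      λ { {[ d ]} {[ e ]} d∈D e∈D → let (z , z∈D , d≤z , e≤z) = D-dir d∈D e∈D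
                                    in [ z ] , z∈D , AddInfimum.[ d≤z ] , AddInfimum.[ e≤z ] }

    D₋-upper-bound : ∀ {x} → x ∈ D₋ → Poset._≤_ (addBottom P) x [ s ]
    D₋-upper-bound {[ d ]} d∈D = AddInfimum.[ upper-bound d∈D ]

    D₋-least : ∀ {z} → (∀ {x} → x ∈ D₋ → Poset._≤_ (addBottom P) x z) → Poset._≤_ (addBottom P) [ s ] z
    D₋-least {⊥₋} bound with bound {[ d₀ ]} d₀∈D
    ... | ()
    D₋-least {[ z ]} bound =
      AddInfimum.[ least (λ {x} x∈D → AddInfimum.[≤]-injective _≤_ (bound {[ x ]} x∈D)) ]
  ... | [ d ] , d∈D , d∈V = d , d∈D , d∈V

module _ (em : ExcludedMiddle 1ℓ) where

  i-continuous : IsContinuous ℝ-space 𝐈ℝ-space i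
  i-continuous V (V↑ , V-acc) {x} x∈V =
    let (I , I∈D , I∈V)            = V-acc D D-dir D-sup x∈V
        (p , q , p≤q , x∈ , I≡) = unsmall em I∈D
    in p , q , x∈ , λ {y} (p∈ , q∈) →
       V↑ {[ p , q ]⟨ p≤q ⟩} {i y}
          (λ (y≤r , r≤y) → (λ u<p → y≤r (lower-≤ y (ℚₚ.<⇒≤ u<p) p∈)) ,
                           λ u∈ → lower<upper y (r≤y u∈) q∈)
          (subst (_∈ V) I≡ I∈V)
    where
    -- the intervals [p,q] with p < x < q form a directed family with supremum [x,x]
    D : Subset 𝐈ℝ
    D I = Small em (∃[ p ] ∃[ q ] Σ[ p≤q ∈ p ℚ.≤ q ] x ∈ ⦅ p , q ⦆ × I ≡ [ p , q ]⟨ p≤q ⟩)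

    inD : ∀ {p q} → p ∈ lower x → q ∈ upper x → Σ[ p≤q ∈ p ℚ.≤ q ] [ p , q ]⟨ p≤q ⟩ ∈ D
    inD p∈ q∈ = let p≤q = ℚₚ.<⇒≤ (lower<upper x p∈ q∈) in
                p≤q , small em (_ , _ , p≤q , (p∈ , q∈) , refl)

    D-dir : Directed 𝐈ℝ-poset D
    D-dir =
      (let (p , p∈) = ℝ.lower-inhabited x
           (q , q∈) = ℝ.upper-inhabited x
       in _ , proj₂ (inD p∈ q∈)) ,
      λ I∈D J∈D → bound (unsmall em I∈D) (unsmall em J∈D)
      where
      bound : ∀ {I J} →
              ∃[ p ] ∃[ q ] Σ[ p≤q ∈ p ℚ.≤ q ] x ∈ ⦅ p , q ⦆ × I ≡ [ p , q ]⟨ p≤q ⟩ →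
              ∃[ p ] ∃[ q ] Σ[ p≤q ∈ p ℚ.≤ q ] x ∈ ⦅ p , q ⦆ × J ≡ [ p , q ]⟨ p≤q ⟩ →
              ∃[ K ] K ∈ D × (∀ {r} → r ∈ᴵ K → r ∈ᴵ I) × (∀ {r} → r ∈ᴵ K → r ∈ᴵ J)
      bound (p , q , _ , (p∈ , q∈) , refl) (p′ , q′ , _ , (p′∈ , q′∈) , refl) =
        let (s , s∈ , p≤s , p′≤s) = lower-⊔ x p∈ p′∈
            (t , t∈ , t≤q , t≤q′) = upper-⊓ x q∈ q′∈
        in _ , proj₂ (inD s∈ t∈) ,
           (λ {r} (s≤r , r≤t) → (λ u<p → s≤r (ℚₚ.<-≤-trans u<p p≤s)) , λ u∈ → ℚₚ.<-≤-trans (r≤t u∈) t≤q) ,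
           (λ {r} (s≤r , r≤t) → (λ u<p → s≤r (ℚₚ.<-≤-trans u<p p′≤s)) , λ u∈ → ℚₚ.<-≤-trans (r≤t u∈) t≤q′)

    D-sup : IsSup 𝐈ℝ-poset D (i x)
    D-sup = (λ {I} I∈D {r} → upper-bound {I} (unsmall em I∈D) {r}) , λ {z} → least {z}
      where
      upper-bound : ∀ {I} → ∃[ p ] ∃[ q ] Σ[ p≤q ∈ p ℚ.≤ q ] x ∈ ⦅ p , q ⦆ × I ≡ [ p , q ]⟨ p≤q ⟩ →
                    ∀ {r} → r ∈ᴵ i x → r ∈ᴵ I
      upper-bound (p , q , _ , (p∈ , q∈) , refl) (x≤r , r≤x) =
        (λ u<p → x≤r (lower-≤ x (ℚₚ.<⇒≤ u<p) p∈)) , λ u∈ → lower<upper x (r≤x u∈) q∈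

      least : ∀ {z} → (∀ {I} → I ∈ D → ∀ {r} → r ∈ᴵ z → r ∈ᴵ I) → ∀ {r} → r ∈ᴵ z → r ∈ᴵ i x
      least bound {r} r∈z = x≤r , r≤x
        where
        r∈[_,_] : ∀ {p q} (p∈ : p ∈ lower x) (q∈ : q ∈ upper x) → r ∈ᴵ [ p , q ]⟨ proj₁ (inD p∈ q∈) ⟩
        r∈[ p∈ , q∈ ] = bound (proj₂ (inD p∈ q∈)) {r} r∈z

        x≤r : x ≤ᴿ r
        x≤r u∈ = let (p , u<p , p∈) = ℝ.lower-rounded x u∈
                     (q , q∈)       = ℝ.upper-inhabited x
                 in proj₁ r∈[ p∈ , q∈ ] u<p

        r≤x : r ≤ᴿ x
        r≤x {u} u∈ with ℝ.lower-rounded r u∈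
        ... | v , u<v , v∈ with ℝ.located x u<v
        ...   | inj₁ u∈x = u∈x
        ...   | inj₂ v∈x = let (p , p∈) = ℝ.lower-inhabited x in
                           ⊥-elim (ℚₚ.<-irrefl refl (proj₂ r∈[ p∈ , v∈x ] v∈))

  i⊥-continuous : IsContinuous ℝ-space 𝐈ℝ⊥-space i⊥
  i⊥-continuous V V-open = i-continuous ([_] ⊢ V) ([]-continuous 𝐈ℝ-poset V V-open)

{-# OPTIONS --safe #-}

-- Split ℝ successively along an enumeration of the rational open intervals.
-- After n steps this is a finite Borel partition; a cell inside at least one of
-- the first n intervals is enclosed in their rational intersection I, and
-- contributes min(μ(cell), bₙ) δ_I, where bₙ → +∞; the other cell contributes
-- nothing.  These simple valuations increase with n, as truncation is
-- subadditive and smaller cells have smaller, hence higher, enclosures.  On an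
-- open set V the n-th one lies between min(μ(Eₙ), bₙ) and μ(Eₙ), where Eₙ is the
-- union of the cells whose enclosure is in V.  The sets Eₙ increase to the
-- preimage of V, so the supremum is the image of μ, even if μ takes the value +∞
-- on bounded sets.

module Submission where

open import Defs
open Space using (IsOpen) renaming (Carrier to ∣_∣)
open import Axiom.ExcludedMiddle using (ExcludedMiddle)
open import Data.Empty using (⊥-elim)
open import Data.List.Base using (List; []; _∷_; _++_)
open import Data.Maybe.Base using (Maybe; just; nothing)
open import Data.Maybe.Relation.Unary.All using (All; just; nothing)
open import Data.Maybe.Relation.Unary.Any using (Any; just)
open import Data.Nat.Base as ℕ using (ℕ; zero; suc)
import Data.Nat.Properties as ℕₚ
open import Data.Product.Base using (∃; ∃-syntax; _×_; _,_; proj₁; proj₂)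
open import Data.Rational.Base as ℚ using (ℚ; 0ℚ; 1ℚ)
import Data.Rational.Properties as ℚₚ
open import Data.Rational.Solver using (module +-*-Solver)
open import Data.Sum.Base using (_⊎_; inj₁; inj₂)
open import Data.Unit.Base using (tt)
open import Function.Base using (_∘_; id)
open import Relation.Binary.Bundles using (Poset)
open import Relation.Binary.Construct.Interior.Symmetric using (_,_; lhs≤rhs; rhs≤lhs)
open import Relation.Binary.PropositionalEquality.Core using (_≡_; refl; sym; trans; cong; cong₂; subst)
open import Relation.Nullary.Construct.Add.Infimum using ([_])
open import Relation.Nullary.Decidable.Core using (yes; no)
open import Relation.Unary using (_∈_; _⊆_; _∪_; _∩_; _∖_; _⊢_; ⋃; ∅; U)

-- Indicator multiples and truncation in the extended half-line.

+⁺-interchange : ∀ w x y z → (w +⁺ x) +⁺ (y +⁺ z) ≈⁺ (w +⁺ y) +⁺ (x +⁺ z)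
+⁺-interchange w x y z = swap w x y z , swap w y x z
  where
  swap : ∀ w x y z → (w +⁺ x) +⁺ (y +⁺ z) ≤⁺ (w +⁺ y) +⁺ (x +⁺ z)
  swap _ _ _ _ (_ , _ , (p , q , p∈ , q∈ , refl) , (r , s , r∈ , s∈ , refl) , refl) =
    p ℚ.+ r , q ℚ.+ s , (p , r , p∈ , r∈ , refl) , (q , s , q∈ , s∈ , refl) ,
    solve 4 (λ p q r s → (p :+ q) :+ (r :+ s) := (p :+ r) :+ (q :+ s)) refl p q r s
    where open +-*-Solver

when-mono : ∀ r {A B} → (A → B) → r when A ≤⁺ r when B
when-mono _ f (inj₁ q<0)       = inj₁ q<0
when-mono _ f (inj₂ (a , q∈r)) = inj₂ (f a , q∈r)

when-modular : ∀ r A B → (r when (A ⊎ B)) +⁺ (r when (A × B)) ≈⁺ (r when A) +⁺ (r when B)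
when-modular r A B = to , from
  where
  to : (r when (A ⊎ B)) +⁺ (r when (A × B)) ≤⁺ (r when A) +⁺ (r when B)
  to (p , q , inj₁ p<0 , q∈ , eq)             = p , q , inj₁ p<0 , when-mono r proj₂ q∈ , eq
  to (p , q , inj₂ (inj₁ a , p∈r) , q∈ , eq)  = p , q , inj₂ (a , p∈r) , when-mono r proj₂ q∈ , eq
  to (p , q , inj₂ (inj₂ b , p∈r) , q∈ , eq)  =
    q , p , when-mono r proj₁ q∈ , inj₂ (b , p∈r) , trans eq (ℚₚ.+-comm p q)

  from : (r when A) +⁺ (r when B) ≤⁺ (r when (A ⊎ B)) +⁺ (r when (A × B))
  -- A negative summand lies in every cut, so it is the one that can go to the conjunction.
  from (p , q , inj₁ p<0 , q∈ , eq) = q , p , when-mono r inj₂ q∈ , inj₁ p<0 , trans eq (ℚₚ.+-comm p q)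
  from (p , q , inj₂ (a , p∈r) , inj₁ q<0 , eq)       = p , q , inj₂ (inj₁ a , p∈r) , inj₁ q<0 , eq
  from (p , q , inj₂ (a , p∈r) , inj₂ (b , q∈r) , eq) = p , q , inj₂ (inj₁ a , p∈r) , inj₂ ((a , b) , q∈r) , eq

-- The minimum of `x` and `b`, as an intersection of cuts; `0≤b` keeps all negative rationals in it.
truncate : ∀ b → 0ℚ ℚ.≤ b → ℝ̄₊ → ℝ̄₊
truncate b 0≤b x = record
  { below    = λ q → q ℚ.< b × q ∈ below x
  ; negative = λ q<0 → ℚₚ.<-≤-trans q<0 0≤b , negative x q<0
  ; downward = λ p<q (q<b , q∈x) → ℚₚ.<-trans p<q q<b , downward x p<q q∈x
  ; rounded  = λ (q<b , q∈x) → round (ℚₚ.<-dense q<b) (rounded x q∈x)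
  }
  where
  round : ∀ {q} → ∃[ r ] q ℚ.< r × r ℚ.< b → ∃[ s ] q ℚ.< s × s ∈ below x →
          ∃[ t ] q ℚ.< t × t ℚ.< b × t ∈ below x
  round (r , q<r , r<b) (s , q<s , s∈x) with r ℚₚ.<? s
  ... | yes r<s = r , q<r , r<b , downward x r<s s∈x
  ... | no r≮s  = s , q<s , ℚₚ.≤-<-trans (ℚₚ.≮⇒≥ r≮s) r<b , s∈x

-- The rational `p` shows that `x` is at least `b`, so the first truncated summand equals `b`. The
-- second is nonnegative and has to supply only the negative `q - r`.
truncate-absorbs : ∀ b 0≤b x y {p q} → p ∈ below x → b ℚ.≤ p → q ℚ.< b →
                   q ∈ below (truncate b 0≤b x +⁺ truncate b 0≤b y)
truncate-absorbs b 0≤b x y {p} {q} p∈x b≤p q<b =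
  let (r , q<r , r<b) = ℚₚ.<-dense q<b
      q-r<0           = subst (q ℚ.- r ℚ.<_) (ℚₚ.+-inverseʳ r) (<-sub r q<r)
  in r , q ℚ.- r ,
     (r<b , downward x (ℚₚ.<-≤-trans r<b b≤p) p∈x) ,
     negative (truncate b 0≤b y) q-r<0 ,
     sym (trans (ℚₚ.+-comm r (q ℚ.- r)) (p-q+q≡p q r))

-- If both witnessing summands are below `b`, truncation leaves them alone; otherwise one truncated
-- summand already reaches `b`.
truncate-+⁺ : ∀ b 0≤b x y → truncate b 0≤b (x +⁺ y) ≤⁺ truncate b 0≤b x +⁺ truncate b 0≤b y
truncate-+⁺ b 0≤b x y (r<b , p , q , p∈x , q∈y , eq) with p ℚₚ.<? b | q ℚₚ.<? b
... | yes p<b | yes q<b = p , q , (p<b , p∈x) , (q<b , q∈y) , eq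
... | no p≮b  | _       = truncate-absorbs b 0≤b x y p∈x (ℚₚ.≮⇒≥ p≮b) r<b
... | yes _   | no q≮b  = lhs≤rhs (+⁺-comm (truncate b 0≤b y) (truncate b 0≤b x))
                            (truncate-absorbs b 0≤b y x q∈y (ℚₚ.≮⇒≥ q≮b) r<b)

-- A running maximum is nonnegative and increasing by construction, and it is unbounded because
-- every rational is enumerated.
ceiling : ℕ → ℚ
ceiling zero    = 0ℚ
ceiling (suc n) = ceiling n ℚ.⊔ enumℚ n

0≤ceiling : ∀ n → 0ℚ ℚ.≤ ceiling n
0≤ceiling zero    = ℚₚ.≤-refl
0≤ceiling (suc n) = ℚₚ.≤-trans (0≤ceiling n) (ℚₚ.p≤p⊔q (ceiling n) (enumℚ n))

cap : ℕ → ℝ̄₊ → ℝ̄₊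
cap n = truncate (ceiling n) (0≤ceiling n)

-- The reason for capping: a simple valuation has finite coefficients, whereas a cell may have
-- infinite measure.
cap-finite : ∀ n x → IsFinite (cap n x)
cap-finite n x = ceiling n , λ (b<b , _) → ℚₚ.<-irrefl refl b<b

cap-mono : ∀ n x y → x ≤⁺ y → cap n x ≤⁺ cap n y
cap-mono n x y x≤y (q<b , q∈x) = q<b , x≤y q∈x

cap-step : ∀ n x → cap n x ≤⁺ cap (suc n) x
cap-step n x (q<b , q∈x) = ℚₚ.<-≤-trans q<b (ℚₚ.p≤p⊔q (ceiling n) (enumℚ n)) , q∈x

ceiling-mono : ∀ {m n} → m ℕ.≤′ n → ceiling m ℚ.≤ ceiling n
ceiling-mono ℕ.≤′-refl = ℚₚ.≤-refl
ceiling-mono {n = suc n} (ℕ.≤′-step m≤n) =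
  ℚₚ.≤-trans (ceiling-mono m≤n) (ℚₚ.p≤p⊔q (ceiling n) (enumℚ n))

ceiling-unbounded : ∀ q → ∃[ n ] q ℚ.< ceiling n
ceiling-unbounded q =
  -- Adding 1 makes the inequality strict. The `k`-th rational enters the maximum only at stage
  -- `suc k`.
  let (k , e) = enumℚ-surjective (q ℚ.+ 1ℚ)
  in suc k , ℚₚ.<-≤-trans
       (subst (ℚ._< q ℚ.+ 1ℚ) (ℚₚ.+-identityʳ q) (ℚₚ.+-monoʳ-< q (ℚₚ.positive⁻¹ 1ℚ)))
       (subst (ℚ._≤ ceiling (suc k)) e (ℚₚ.p≤q⊔p (ceiling k) (enumℚ k)))

-- Simple valuations and suprema of chains of them.

module _ {X : Space} where

  diracSum-mono : ∀ rxs {V W : 𝒪 X} → set V ⊆ set W → diracSum rxs V ≤⁺ diracSum rxs W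
  diracSum-mono []                    V⊆W = id
  diracSum-mono (((r , _) , x) ∷ rxs) {V} {W} V⊆W =
    +⁺-mono (r when (x ∈ set V)) (r when (x ∈ set W)) (diracSum rxs V) (diracSum rxs W)
      (when-mono r V⊆W) (diracSum-mono rxs {V} {W} V⊆W)

  diracSum-strict : ∀ rxs → diracSum {X} rxs ∅ᵒ ≤⁺ 0⁺
  diracSum-strict [] = id
  diracSum-strict (((r , _) , x) ∷ rxs) =
    lhs≤rhs (+⁺-identityʳ 0⁺) ∘
    +⁺-mono (r when (x ∈ ∅)) 0⁺ (diracSum {X} rxs ∅ᵒ) 0⁺ (λ { (inj₁ q<0) → q<0 }) (diracSum-strict rxs)

  diracSum-modular : ∀ rxs (V W : 𝒪 X) →
    diracSum rxs (V ∪ᵒ W) +⁺ diracSum rxs (V ∩ᵒ W) ≈⁺ diracSum rxs V +⁺ diracSum rxs W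
  diracSum-modular [] V W = id , id
  diracSum-modular (((r , _) , x) ∷ rxs) V W = begin
    (r∈ (V ∪ᵒ W) +⁺ rest (V ∪ᵒ W)) +⁺ (r∈ (V ∩ᵒ W) +⁺ rest (V ∩ᵒ W))
      ≈⟨ +⁺-interchange (r∈ (V ∪ᵒ W)) (rest (V ∪ᵒ W)) (r∈ (V ∩ᵒ W)) (rest (V ∩ᵒ W)) ⟩
    (r∈ (V ∪ᵒ W) +⁺ r∈ (V ∩ᵒ W)) +⁺ (rest (V ∪ᵒ W) +⁺ rest (V ∩ᵒ W))
      ≈⟨ +⁺-cong (r∈ (V ∪ᵒ W) +⁺ r∈ (V ∩ᵒ W)) (r∈ V +⁺ r∈ W)
           (rest (V ∪ᵒ W) +⁺ rest (V ∩ᵒ W)) (rest V +⁺ rest W)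
           (when-modular r (x ∈ set V) (x ∈ set W)) (diracSum-modular rxs V W) ⟩
    (r∈ V +⁺ r∈ W) +⁺ (rest V +⁺ rest W)
      ≈⟨ +⁺-interchange (r∈ V) (r∈ W) (rest V) (rest W) ⟩
    (r∈ V +⁺ rest V) +⁺ (r∈ W +⁺ rest W) ∎
    where
    open ≈⁺-Reasoning

    r∈ rest : 𝒪 X → ℝ̄₊
    r∈ T   = r when (x ∈ set T)
    rest T = diracSum rxs T

  diracSum-++ : ∀ rxs sys (V : 𝒪 X) → diracSum (rxs ++ sys) V ≈⁺ diracSum rxs V +⁺ diracSum sys V
  diracSum-++ [] sys V = rhs≤lhs e , lhs≤rhs e
    where
    e : 0⁺ +⁺ diracSum sys V ≈⁺ diracSum sys V
    e = +⁺-identityˡ (diracSum sys V)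
  diracSum-++ (((r , _) , x) ∷ rxs) sys V = begin
    rₓ +⁺ diracSum (rxs ++ sys) V
      ≈⟨ +⁺-cong rₓ rₓ (diracSum (rxs ++ sys) V) (diracSum rxs V +⁺ diracSum sys V)
           (id , id) (diracSum-++ rxs sys V) ⟩
    rₓ +⁺ (diracSum rxs V +⁺ diracSum sys V)
      ≈⟨ +⁺-assoc rₓ (diracSum rxs V) (diracSum sys V) ⟨
    (rₓ +⁺ diracSum rxs V) +⁺ diracSum sys V ∎
    where
    open ≈⁺-Reasoning

    rₓ : ℝ̄₊
    rₓ = r when (x ∈ set V)

  module _ (em : ExcludedMiddle 1ℓ) where

    -- Only finitely many points have to be caught, so one member of D catches them all.
    diracSum-accessible : ∀ rxs (D : Subset (𝒪 X)) → Directed (𝒪-poset X) D →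
      ∀ {W} → IsSup (𝒪-poset X) D W → ∃[ V ] V ∈ D × diracSum rxs W ≤⁺ diracSum rxs V
    diracSum-accessible [] D ((V₀ , V₀∈D) , _) _ = V₀ , V₀∈D , id
    diracSum-accessible (((r , _) , x) ∷ rxs) D D-dir {W} W-sup
      with diracSum-accessible rxs D D-dir {W} W-sup | em₀ em {x ∈ set W}
    ... | V , V∈D , ≤V | no x∉W = V , V∈D ,
      +⁺-mono (r when (x ∈ set W)) (r when (x ∈ set V)) (diracSum rxs W) (diracSum rxs V)
        (when-mono r (⊥-elim ∘ x∉W)) ≤V
    ... | V , V∈D , ≤V | yes x∈W =
      let (V′ , V′∈D , x∈V′)       = sup-isUnion em {X} D {W} W-sup x∈W
          (T , T∈D , V⊆T , V′⊆T) = proj₂ D-dir V∈D V′∈D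
      in T , T∈D ,
         +⁺-mono (r when (x ∈ set W)) (r when (x ∈ set T)) (diracSum rxs W) (diracSum rxs T)
           (when-mono r (λ _ → V′⊆T x∈V′)) (diracSum-mono rxs {V} {T} V⊆T ∘ ≤V)

    simpleValuation : List (ℝ₊ × ∣ X ∣) → 𝐕 X
    simpleValuation rxs = record
      { value           = diracSum rxs
      ; scottContinuous = (λ {V} {W} → diracSum-mono rxs {V} {W}) , λ D D-dir {W} W-sup →
          (λ { (V , V∈D , refl) → diracSum-mono rxs {V} {W} (proj₁ W-sup V∈D) }) ,
          λ bound → let (V , V∈D , ≤V) = diracSum-accessible rxs D D-dir {W} W-sup in
                    bound (V , V∈D , refl) ∘ ≤V
      ; strict          = diracSum-strict rxs , negative (diracSum {X} rxs ∅ᵒ)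
      ; modular         = diracSum-modular rxs
      }

    -- A pointwise supremum that is itself a valuation is the supremum in `𝐕 X`, so leastness can be
    -- tested on one open set at a time.
    chain-sup-minimal : (rxs : ℕ → List (ℝ₊ × ∣ X ∣)) →
      (∀ n V → diracSum {X} (rxs n) V ≤⁺ diracSum (rxs (suc n)) V) →
      ∀ {ξ} → (∀ n V → diracSum (rxs n) V ≤⁺ value ξ V) →
      (∀ V z → (∀ n → diracSum (rxs n) V ≤⁺ z) → value ξ V ≤⁺ z) →
      IsMinimal ξ
    chain-sup-minimal rxs step {ξ} upper-bound least =
      directedSup D
        ((ν 0 , small em (0 , refl)) , λ x∈D y∈D → bound (unsmall em x∈D) (unsmall em y∈D))
        (λ μ∈D → minimal (unsmall em μ∈D))
        ((λ μ∈D → below-ξ (unsmall em μ∈D)) ,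
         λ {ζ} ζ-bound V → least V (value ζ V) λ n → ζ-bound {ν n} (small em (n , refl)) V)
      where
      ν : ℕ → 𝐕 X
      ν n = simpleValuation (rxs n)

      D : Subset (𝐕 X)
      D μ = Small em (∃[ n ] μ ≡ ν n)

      steps : ∀ {m n} → m ℕ.≤′ n → ∀ V → diracSum (rxs m) V ≤⁺ diracSum (rxs n) V
      steps ℕ.≤′-refl V = id
      steps {n = suc n} (ℕ.≤′-step m≤n) V = step n V ∘ steps m≤n V

      bound : ∀ {x y} → ∃[ n ] x ≡ ν n → ∃[ n ] y ≡ ν n →
              ∃[ z ] z ∈ D × (∀ V → value x V ≤⁺ value z V) × (∀ V → value y V ≤⁺ value z V)
      bound (m , refl) (n , refl) = ν (m ℕ.⊔ n) , small em (m ℕ.⊔ n , refl) ,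
        steps (ℕₚ.≤⇒≤′ (ℕₚ.m≤m⊔n m n)) , steps (ℕₚ.≤⇒≤′ (ℕₚ.m≤n⊔m m n))

      minimal : ∀ {μ} → ∃[ n ] μ ≡ ν n → IsMinimal μ
      minimal (n , refl) = simple (rxs n , λ V → id , id)

      below-ξ : ∀ {μ} → ∃[ n ] μ ≡ ν n → ∀ V → value μ V ≤⁺ value ξ V
      below-ξ (n , refl) = upper-bound n

-- Rational windows, their enclosing intervals, and cells.

Between : ℚ × ℚ → Subset ℝ
Between (p , q) = ⦅ p , q ⦆

between-borel : ∀ w → IsBorel ℝ-space (Between w)
between-borel (p , q) = borel-open (λ {x} → ⦅⦆-open p q {x})

-- [p,q] when p ≤ q, which is the case as soon as ⦅ p , q ⦆ is inhabited
enclosure : ℚ × ℚ → 𝐈ℝ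
enclosure (p , q) = [ p , p ℚ.⊔ q ]⟨ ℚₚ.p≤p⊔q p q ⟩

_≼_ : ℚ × ℚ → ℚ × ℚ → Set
(p , q) ≼ (p′ , q′) = p ℚ.≤ p′ × q′ ℚ.≤ q

open Poset 𝐈ℝ-poset using () renaming (_≤_ to _⊑_)

-- The point `x` forces `p′ < q′`, so that the right end of the finer enclosure is `q′` rather than
-- `p′`.
enclosure-mono : ∀ {v w x} → v ≼ w → x ∈ Between w → enclosure v ⊑ enclosure w
enclosure-mono {p , q} {p′ , q′} {x} (p≤p′ , q′≤q) (p′∈ , q′∈) (p′≤r , r≤) =
  (λ u<p → p′≤r (ℚₚ.<-≤-trans u<p p≤p′)) ,
  λ u∈r → ℚₚ.<-≤-trans (r≤ u∈r) (ℚₚ.≤-trans (ℚₚ.⊔-lub (ℚₚ.<⇒≤ (lower<upper x p′∈ q′∈)) ℚₚ.≤-refl)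
            (ℚₚ.≤-trans q′≤q (ℚₚ.p≤q⊔p p q)))

enclosure-⊑-i : ∀ {w x} → x ∈ Between w → enclosure w ⊑ i x
enclosure-⊑-i {p , q} {x} (p∈ , q∈) (x≤r , r≤x) =
  (λ u<p → x≤r (lower-≤ x (ℚₚ.<⇒≤ u<p) p∈)) ,
  λ u∈r → ℚₚ.<-≤-trans (lower<upper x (r≤x u∈r) q∈) (ℚₚ.p≤q⊔p p q)

-- Intersection of open intervals, with `nothing` standing for the whole line.
narrow : Maybe (ℚ × ℚ) → ℚ × ℚ → ℚ × ℚ
narrow nothing        w         = w
narrow (just (p , q)) (p′ , q′) = p ℚ.⊔ p′ , q ℚ.⊓ q′

≼-narrow : ∀ v w → w ≼ narrow v w
≼-narrow nothing        w         = ℚₚ.≤-refl , ℚₚ.≤-refl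
≼-narrow (just (p , q)) (p′ , q′) = ℚₚ.p≤q⊔p p p′ , ℚₚ.p⊓q≤q q q′

just-≼-narrow : ∀ v w → v ≼ narrow (just v) w
just-≼-narrow (p , q) (p′ , q′) = ℚₚ.p≤p⊔q p p′ , ℚₚ.p⊓q≤p q q′

between-narrow : ∀ {v w x} → All (λ u → x ∈ Between u) v → x ∈ Between w →
                 x ∈ Between (narrow v w)
between-narrow {nothing} _ x∈w = x∈w
between-narrow {just (p , q)} {p′ , q′} {x} (just (p∈ , q∈)) (p′∈ , q′∈) =
  lo (ℚₚ.≤-total p p′) , hi (ℚₚ.≤-total q q′)
  where
  lo : p ℚ.≤ p′ ⊎ p′ ℚ.≤ p → p ℚ.⊔ p′ ∈ lower x
  lo (inj₁ p≤p′) = subst (_∈ lower x) (sym (ℚₚ.p≤q⇒p⊔q≡q p≤p′)) p′∈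
  lo (inj₂ p′≤p) = subst (_∈ lower x) (sym (ℚₚ.p≥q⇒p⊔q≡p p′≤p)) p∈

  hi : q ℚ.≤ q′ ⊎ q′ ℚ.≤ q → q ℚ.⊓ q′ ∈ upper x
  hi (inj₁ q≤q′) = subst (_∈ upper x) (sym (ℚₚ.p≤q⇒p⊓q≡p q≤q′)) q∈
  hi (inj₂ q′≤q) = subst (_∈ upper x) (sym (ℚₚ.p≥q⇒p⊓q≡q q′≤q)) q′∈

-- Unlike `enum⦅⦆`, this enumeration keeps the endpoints, from which `enclosure` is computed.
windows : ℕ → ℚ × ℚ
windows k = let (i , j) = unpair k in enumℚ i , enumℚ j

windows-surjective : ∀ w → ∃[ k ] windows k ≡ w
windows-surjective (p , q) =
  let (i , e)  = enumℚ-surjective p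
      (j , e′) = enumℚ-surjective q
      (k , e″) = unpair-surjective i j
  in k , trans (cong (λ (i , j) → enumℚ i , enumℚ j) e″) (cong₂ _,_ e e′)

-- The window is the only part of the region's shape that is remembered; it is
-- `nothing` as long as the region lies outside all intervals used so far.
record Cell : Set₁ where
  field
    region  : Subset ℝ
    borel   : IsBorel ℝ-space region
    window  : Maybe (ℚ × ℚ)
    bounded : ∀ {x} → x ∈ region → All (λ w → x ∈ Between w) window

open Cell

line : Cell
line = record
  { region  = U
  ; borel   = borel-open {A = U} (λ {x} → Space.open-U ℝ-space {x})
  ; window  = nothing
  ; bounded = λ _ → nothing
  }

-- Splitting cells, and approximating points by enclosures.

module _ (em : ExcludedMiddle 1ℓ) where

  -- Only `inner` refines the window: what remains of a region outside an interval need not fit into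
  -- a smaller interval.
  inner outer : ℚ × ℚ → Cell → Cell
  inner w c = record
    { region  = region c ∩ Between w
    ; borel   = borel-∩ em (borel c) (between-borel w)
    ; window  = just (narrow (window c) w)
    ; bounded = λ {x} (x∈c , x∈w) → just (between-narrow {window c} {w} {x} (bounded c x∈c) x∈w)
    }
  outer w c = record
    { region  = region c ∖ Between w
    ; borel   = borel-∖ em (borel c) (between-borel w)
    ; window  = window c
    ; bounded = λ (x∈c , _) → bounded c x∈c
    }

  -- the intervals [p,q] with p < x < q form a directed family with supremum [x,x]
  enclosure-accessible : ∀ {V} → IsOpen 𝐈ℝ-space V → ∀ {x} → i x ∈ V →
                         ∃[ w ] x ∈ Between w × enclosure w ∈ V
  enclosure-accessible {V} (_ , V-acc) {x} x∈V =
    let (I , I∈D , I∈V)  = V-acc D (inhabited , λ I∈D J∈D → directed (unsmall em I∈D) (unsmall em J∈D))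
                             ((λ {I} I∈D {r} → upper-bound {I} (unsmall em I∈D) {r}) , λ {z} → least {z}) x∈V
        (w , x∈w , I≡w) = unsmall em I∈D
    in w , x∈w , subst (_∈ V) I≡w I∈V
    where
    D′ : 𝐈ℝ → Set₁
    D′ I = ∃[ w ] x ∈ Between w × I ≡ enclosure w

    D : Subset 𝐈ℝ
    D I = Small em (D′ I)

    inD : ∀ w → x ∈ Between w → enclosure w ∈ D
    inD w x∈w = small em (w , x∈w , refl)

    inhabited : ∃ D
    inhabited = let (p , p∈) = ℝ.lower-inhabited x
                    (q , q∈) = ℝ.upper-inhabited x
                in _ , inD (p , q) (p∈ , q∈)

    directed : ∀ {I J} → D′ I → D′ J → ∃[ K ] K ∈ D × (I ⊑ K) × (J ⊑ K)
    directed (v , x∈v , refl) (w , x∈w , refl) =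
      let x∈vw = between-narrow {just v} {w} {x} (just x∈v) x∈w
      in enclosure (narrow (just v) w) , inD _ x∈vw ,
         (λ {r} → enclosure-mono {v} {narrow (just v) w} {x} (just-≼-narrow v w) x∈vw {r}) ,
         (λ {r} → enclosure-mono {w} {narrow (just v) w} {x} (≼-narrow (just v) w) x∈vw {r})

    upper-bound : ∀ {I} → D′ I → I ⊑ i x
    upper-bound (w , x∈w , refl) {r} = enclosure-⊑-i {w} {x} x∈w {r}

    least : ∀ {z} → (∀ {I} → I ∈ D → I ⊑ z) → i x ⊑ z
    least bound {r} r∈z = x≤r , r≤x
      where
      r∈[_,_] : ∀ {p q} → p ∈ lower x → q ∈ upper x → r ∈ᴵ enclosure (p , q)
      r∈[ p∈ , q∈ ] = bound (inD _ (p∈ , q∈)) {r} r∈z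

      x≤r : x ≤ᴿ r
      x≤r u∈x = let (p , u<p , p∈) = ℝ.lower-rounded x u∈x
                    (q , q∈)       = ℝ.upper-inhabited x
                in proj₁ r∈[ p∈ , q∈ ] u<p

      r≤x : r ≤ᴿ x
      r≤x {u} u∈r with ℝ.lower-rounded r u∈r
      ... | v , u<v , v∈r with ℝ.located x u<v
      ...   | inj₁ u∈x = u∈x
      -- Here `v` is above `x`, so the enclosure of `(p , v)` has right end `v` and cannot contain
      -- `r`, which is above `v`.
      ...   | inj₂ v∈x =
        let (p , p∈) = ℝ.lower-inhabited x
            p<v      = lower<upper x p∈ v∈x
        in ⊥-elim (ℚₚ.<-irrefl refl
             (subst (v ℚ.<_) (ℚₚ.p≤q⇒p⊔q≡q (ℚₚ.<⇒≤ p<v)) (proj₂ r∈[ p∈ , v∈x ] v∈r)))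

  -- The approximating simple valuations and their values on an open set.

  module _ (μ : Measure ℝ-space) {X : Space} (g : 𝐈ℝ → ∣ X ∣) where

    -- A cell without a window gets no atom: `𝐈ℝ` has no least element at which its mass could be
    -- placed.
    atom : ℕ → ℝ̄₊ → Maybe (ℚ × ℚ) → List (ℝ₊ × ∣ X ∣)
    atom m r nothing  = []
    atom m r (just w) = ((cap m r , cap-finite m r) , g (enclosure w)) ∷ []

    -- The cap index `m` is kept apart from the depth `n`, because the recursion lowers `n` while
    -- all leaves share one cap.
    atoms : ℕ → ℕ → (ℕ → ℚ × ℚ) → Cell → List (ℝ₊ × ∣ X ∣)
    atoms m zero    s c = atom m (measure μ (region c) (borel c)) (window c)
    atoms m (suc n) s c = atoms m n (s ∘ suc) (inner (s 0) c) ++ atoms m n (s ∘ suc) (outer (s 0) c)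

    module _ (V : 𝒪 X) where

      Good : Maybe (ℚ × ℚ) → Set
      Good = Any (λ w → g (enclosure w) ∈ set V)

      -- the union of the cells at depth n whose window is sent into V
      Caught : ℕ → (ℕ → ℚ × ℚ) → Cell → Subset ℝ
      Caught zero    s c x = x ∈ region c × Good (window c)
      Caught (suc n) s c   = Caught n (s ∘ suc) (inner (s 0) c) ∪ Caught n (s ∘ suc) (outer (s 0) c)

      caught-⊆ : ∀ n s c → Caught n s c ⊆ region c
      caught-⊆ zero    s c (x∈c , _) = x∈c
      caught-⊆ (suc n) s c (inj₁ x∈) = proj₁ (caught-⊆ n (s ∘ suc) (inner (s 0) c) x∈)
      caught-⊆ (suc n) s c (inj₂ x∈) = proj₁ (caught-⊆ n (s ∘ suc) (outer (s 0) c) x∈)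

      -- At a leaf the condition on the window does not depend on the point, so the set is either
      -- the whole region or empty.
      caught-borel : ∀ n s c → IsBorel ℝ-space (Caught n s c)
      caught-borel zero s c with em₀ em {Good (window c)}
      ... | yes good = borel-resp ((λ x∈c → x∈c , good) , proj₁) (borel c)
      ... | no ¬good = borel-resp ((λ ()) , λ (_ , good) → ⊥-elim (¬good good)) borel-∅
      caught-borel (suc n) s c =
        borel-∪ (caught-borel n (s ∘ suc) (inner (s 0) c)) (caught-borel n (s ∘ suc) (outer (s 0) c))

      size : ℕ → (ℕ → ℚ × ℚ) → Cell → ℝ̄₊
      size n s c = measure μ (Caught n s c) (caught-borel n s c)

      size-split : ∀ n s c → size (suc n) s c ≈⁺
                   size n (s ∘ suc) (inner (s 0) c) +⁺ size n (s ∘ suc) (outer (s 0) c)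
      size-split n s c = measure-∪ μ
        (caught-borel n (s ∘ suc) (inner (s 0) c)) (caught-borel n (s ∘ suc) (outer (s 0) c))
        (caught-borel (suc n) s c) (id , id)
        (λ (x∈inner , x∈outer) → proj₂ (caught-⊆ n (s ∘ suc) (outer (s 0) c) x∈outer)
                                        (proj₂ (caught-⊆ n (s ∘ suc) (inner (s 0) c) x∈inner)))

      -- An atom located outside `V` contributes 0, so the inclusion is required only for a good
      -- window.
      atom-≤ : ∀ m {A B} (a : IsBorel ℝ-space A) (b : IsBorel ℝ-space B) v → (Good v → A ⊆ B) →
               diracSum {X} (atom m (measure μ A a) v) V ≤⁺ cap m (measure μ B b)
      atom-≤ m {A} {B} a b nothing  A⊆B q∈ = negative (cap m (measure μ B b)) q∈
      atom-≤ m {A} {B} a b (just w) A⊆B q∈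
        with lhs≤rhs (+⁺-identityʳ (cap m (measure μ A a) when (g (enclosure w) ∈ set V))) q∈
      ... | inj₁ q<0         = negative (cap m (measure μ B b)) q<0
      ... | inj₂ (good , q∈) = cap-mono m (measure μ A a) (measure μ B b)
        (measure-mono μ em a b (A⊆B (just good))) q∈

      -- If the window is not good, the last hypothesis makes `B` empty, hence of measure 0.
      ≤-atom : ∀ m {A B} (a : IsBorel ℝ-space A) (b : IsBorel ℝ-space B) v →
               B ⊆ A → (∀ {x} → x ∈ B → Good v) →
               cap m (measure μ B b) ≤⁺ diracSum {X} (atom m (measure μ A a) v) V
      ≤-atom m {A} {B} a b v B⊆A good q∈ with em₀ em {Good v}
      ... | yes (just {w} g∈V) =
        rhs≤lhs (+⁺-identityʳ (cap m (measure μ A a) when (g (enclosure w) ∈ set V)))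
          (inj₂ (g∈V , cap-mono m (measure μ B b) (measure μ A a) (measure-mono μ em b a B⊆A) q∈))
      ... | no ¬good = negative (diracSum {X} (atom m (measure μ A a) v) V)
        (lhs≤rhs (measure-∅ μ) (measure-mono μ em b borel-∅ (λ x∈B → ⊥-elim (¬good (good x∈B))) (proj₂ q∈)))

      atoms-≤ : ∀ m n s c → diracSum {X} (atoms m n s c) V ≤⁺ size n s c
      atoms-≤ m zero    s c =
        proj₂ ∘ atom-≤ m (borel c) (caught-borel 0 s c) (window c) (λ good x∈c → x∈c , good)
      atoms-≤ m (suc n) s c =
        rhs≤lhs (size-split n s c) ∘
        +⁺-mono (diracSum (atoms m n (s ∘ suc) (inner (s 0) c)) V) (size n (s ∘ suc) (inner (s 0) c))
                (diracSum (atoms m n (s ∘ suc) (outer (s 0) c)) V) (size n (s ∘ suc) (outer (s 0) c))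
                (atoms-≤ m n (s ∘ suc) (inner (s 0) c)) (atoms-≤ m n (s ∘ suc) (outer (s 0) c)) ∘
        lhs≤rhs (diracSum-++ (atoms m n (s ∘ suc) (inner (s 0) c)) (atoms m n (s ∘ suc) (outer (s 0) c)) V)

      -- At each split the cap is distributed over the two halves by subadditivity of truncation.
      ≤-atoms : ∀ m n s c → cap m (size n s c) ≤⁺ diracSum {X} (atoms m n s c) V
      ≤-atoms m zero    s c = ≤-atom m (borel c) (caught-borel 0 s c) (window c) proj₁ proj₂
      ≤-atoms m (suc n) s c =
        rhs≤lhs (diracSum-++ (atoms m n (s ∘ suc) (inner (s 0) c)) (atoms m n (s ∘ suc) (outer (s 0) c)) V) ∘
        +⁺-mono (cap m (size n (s ∘ suc) (inner (s 0) c))) (diracSum (atoms m n (s ∘ suc) (inner (s 0) c)) V)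
                (cap m (size n (s ∘ suc) (outer (s 0) c))) (diracSum (atoms m n (s ∘ suc) (outer (s 0) c)) V)
                (≤-atoms m n (s ∘ suc) (inner (s 0) c)) (≤-atoms m n (s ∘ suc) (outer (s 0) c)) ∘
        truncate-+⁺ (ceiling m) (0≤ceiling m)
          (size n (s ∘ suc) (inner (s 0) c)) (size n (s ∘ suc) (outer (s 0) c)) ∘
        cap-mono m (size (suc n) s c) (size n (s ∘ suc) (inner (s 0) c) +⁺ size n (s ∘ suc) (outer (s 0) c))
          (lhs≤rhs (size-split n s c))

      -- Growth with the depth, and exhaustion of the preimage.

      module _ (g⁻¹V-open : IsOpen 𝐈ℝ-space (g ⊢ set V)) where

        good-mono : ∀ {v w x} → v ≼ w → x ∈ Between w → Good (just v) → Good (just w)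
        good-mono {v} {w} {x} v≼w x∈w (just v∈) =
          just (proj₁ g⁻¹V-open (λ {r} → enclosure-mono {v} {w} {x} v≼w x∈w {r}) v∈)

        -- A point outside the new interval keeps its window. A point inside gets a narrower one,
        -- whose higher enclosure stays in the upper set `g ⊢ set V`.
        caught-zero⊆one : ∀ s c → Caught 0 s c ⊆ Caught 1 s c
        caught-zero⊆one s c {x} (x∈c , good) with em₀ em {x ∈ Between (s 0)}
        ... | no x∉w  = inj₂ ((x∈c , x∉w) , good)
        ... | yes x∈w with window c | bounded c x∈c
        ...   | just v | x∈v = inj₁ ((x∈c , x∈w) ,
          good-mono {v} {narrow (just v) (s 0)} {x} (just-≼-narrow v (s 0))
            (between-narrow {just v} {s 0} {x} x∈v x∈w) good)
        caught-zero⊆one s c {x} (x∈c , ()) | yes x∈w | nothing | _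

        caught-step : ∀ n s c → Caught n s c ⊆ Caught (suc n) s c
        caught-step zero    s c = caught-zero⊆one s c
        caught-step (suc n) s c (inj₁ x∈) = inj₁ (caught-step n (s ∘ suc) (inner (s 0) c) x∈)
        caught-step (suc n) s c (inj₂ x∈) = inj₂ (caught-step n (s ∘ suc) (outer (s 0) c) x∈)

        caught-mono : ∀ {m n} s c → m ℕ.≤′ n → Caught m s c ⊆ Caught n s c
        caught-mono s c ℕ.≤′-refl x∈ = x∈
        caught-mono {n = suc n} s c (ℕ.≤′-step m≤n) x∈ = caught-step n s c (caught-mono s c m≤n x∈)

        caught-sound : ∀ n s c → Caught n s c ⊆ (λ x → g (i x) ∈ set V)
        caught-sound zero s c {x} (x∈c , good) with window c | bounded c x∈c
        caught-sound zero s c {x} (x∈c , just w∈V) | just w | just x∈w =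
          proj₁ g⁻¹V-open (λ {r} → enclosure-⊑-i {w} {x} x∈w {r}) w∈V
        caught-sound (suc n) s c (inj₁ x∈) = caught-sound n (s ∘ suc) (inner (s 0) c) x∈
        caught-sound (suc n) s c (inj₂ x∈) = caught-sound n (s ∘ suc) (outer (s 0) c) x∈

        -- The earlier splits merely follow `x` into its cell. Splitting along `s k` then makes the
        -- window of `x` at least as narrow as `s k`; this split produces depth `suc k`.
        caught-at : ∀ k s c {x} → x ∈ region c → x ∈ Between (s k) → g (enclosure (s k)) ∈ set V →
                    x ∈ Caught (suc k) s c
        caught-at zero s c {x} x∈c x∈w w∈V = inj₁ ((x∈c , x∈w) ,
          good-mono {s 0} {narrow (window c) (s 0)} {x} (≼-narrow (window c) (s 0))
            (between-narrow {window c} {s 0} {x} (bounded c x∈c) x∈w) (just w∈V))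
        caught-at (suc k) s c {x} x∈c x∈w w∈V with em₀ em {x ∈ Between (s 0)}
        ... | yes x∈s₀ = inj₁ (caught-at k (s ∘ suc) (inner (s 0) c) (x∈c , x∈s₀) x∈w w∈V)
        ... | no x∉s₀  = inj₂ (caught-at k (s ∘ suc) (outer (s 0) c) (x∈c , x∉s₀) x∈w w∈V)

        -- Only a leaf needs an argument: its weight on `V` is at most the capped measure of
        -- `Caught`, which grows with depth and cap, and `≤-atoms` spreads this over the two halves.
        atoms-step : ∀ m n s c → diracSum {X} (atoms m n s c) V ≤⁺ diracSum (atoms (suc m) (suc n) s c) V
        atoms-step m zero s c =
          ≤-atoms (suc m) 1 s c ∘
          cap-step m (size 1 s c) ∘
          cap-mono m (size 0 s c) (size 1 s c)
            (measure-mono μ em (caught-borel 0 s c) (caught-borel 1 s c) (caught-step 0 s c)) ∘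
          atom-≤ m (borel c) (caught-borel 0 s c) (window c) (λ good x∈c → x∈c , good)
        atoms-step m (suc n) s c =
          rhs≤lhs (diracSum-++ inner′ outer′ V) ∘
          +⁺-mono (diracSum innerₙ V) (diracSum inner′ V) (diracSum outerₙ V) (diracSum outer′ V)
            (atoms-step m n (s ∘ suc) (inner (s 0) c)) (atoms-step m n (s ∘ suc) (outer (s 0) c)) ∘
          lhs≤rhs (diracSum-++ innerₙ outerₙ V)
          where
          innerₙ outerₙ inner′ outer′ : List (ℝ₊ × ∣ X ∣)
          innerₙ = atoms m n (s ∘ suc) (inner (s 0) c)
          outerₙ = atoms m n (s ∘ suc) (outer (s 0) c)
          inner′ = atoms (suc m) (suc n) (s ∘ suc) (inner (s 0) c)
          outer′ = atoms (suc m) (suc n) (s ∘ suc) (outer (s 0) c)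

        -- The measure of a countable union is approached along its initial parts, and these lie in
        -- single sets `E n` because the `E n` increase.
        ≤-atoms-sup : (s : ℕ → ℚ × ℚ) → (∀ w → ∃[ k ] s k ≡ w) → ∀ c → U ⊆ region c →
          (a : IsBorel ℝ-space (λ x → g (i x) ∈ set V)) → ∀ z →
          (∀ n → diracSum {X} (atoms n n s c) V ≤⁺ z) →
          measure μ (λ x → g (i x) ∈ set V) a ≤⁺ z
        ≤-atoms-sup s s-surj c all a z bound =
          measure-⋃-≤ μ em E e z initial≤z ∘ measure-mono μ em a (borel-⋃ e) covered
          where
          E : ℕ → Subset ℝ
          E n = Caught n s c

          e : ∀ n → IsBorel ℝ-space (E n)
          e n = caught-borel n s c

          covered : (λ x → g (i x) ∈ set V) ⊆ ⋃ ℕ E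
          covered {x} x∈ =
            let (w , x∈w , w∈V) = enclosure-accessible g⁻¹V-open x∈
                (k , eq)        = s-surj w
            in suc k , caught-at k s c (all tt) (subst (λ w → x ∈ Between w) (sym eq) x∈w)
                         (subst (λ w → g (enclosure w) ∈ set V) (sym eq) w∈V)

          initial⊆ : ∀ n → initial μ em E e n ⊆ E n
          initial⊆ (suc n) (inj₁ x∈) = caught-step n s c (initial⊆ n x∈)
          initial⊆ (suc n) (inj₂ x∈) = caught-step n s c x∈

          initial≤z : ∀ n → measure μ (initial μ em E e n) (initial-borel μ em E e n) ≤⁺ z
          initial≤z n {q} q∈ =
            -- The index `k` lifts the cap above `q`, while `n` gives sufficient depth; the maximum
            -- `m` serves both purposes.
            let (k , q<k) = ceiling-unbounded q
                m         = n ℕ.⊔ k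
            in bound m (≤-atoms m m s c
                 ( ℚₚ.<-≤-trans q<k (ceiling-mono (ℕₚ.≤⇒≤′ (ℕₚ.m≤n⊔m n k)))
                 , measure-mono μ em (initial-borel μ em E e n) (e m)
                     (caught-mono s c (ℕₚ.≤⇒≤′ (ℕₚ.m≤m⊔n n k)) ∘ initial⊆ n) q∈))

    -- A general `g` serves both codomains: `id` for `𝐈ℝ` and `[_]` when a bottom is added. Depth
    -- and cap advance together, starting from the undivided line.
    pushforward-minimal : (s : ℕ → ℚ × ℚ) → (∀ w → ∃[ k ] s k ≡ w) → IsContinuous 𝐈ℝ-space X g →
      (gi-borel : ∀ V → IsBorel ℝ-space (λ x → g (i x) ∈ set V)) →
      ∀ {ξ} → (∀ V → value ξ V ≈⁺ measure μ (λ x → g (i x) ∈ set V) (gi-borel V)) →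
      IsMinimal {X} ξ
    pushforward-minimal s s-surj g-cont gi-borel {ξ} ξ≈ =
      chain-sup-minimal em (λ n → atoms n n s line)
        (λ n V → atoms-step V (g-cont (set V) (isOpen V)) n n s line)
        (λ n V → rhs≤lhs (ξ≈ V)
                 ∘ measure-mono μ em (caught-borel V n s line) (gi-borel V)
                     (caught-sound V (g-cont (set V) (isOpen V)) n s line)
                 ∘ atoms-≤ V n n s line)
        (λ V z bound → ≤-atoms-sup V (g-cont (set V) (isOpen V)) s s-surj line id (gi-borel V) z bound
                       ∘ lhs≤rhs (ξ≈ V))

proposition6p2 : (em : ExcludedMiddle 1ℓ) (μ : Measure ℝ-space) →
    IsMinimal {𝐈ℝ-space} (image em {ℝ-space} {𝐈ℝ-space} i (i-continuous em) (restrict em μ)) ×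
    IsMinimal {𝐈ℝ⊥-space} (image em {ℝ-space} {𝐈ℝ⊥-space} i⊥ (i⊥-continuous em) (restrict em μ))
proposition6p2 em μ =
  pushforward-minimal em μ {𝐈ℝ-space} id windows windows-surjective (λ _ → id)
    (λ V → borel-open (i-continuous em (set V) (isOpen V)))
    (λ V → measure-resp μ _ _ (id , id)) ,
  pushforward-minimal em μ {𝐈ℝ⊥-space} [_] windows windows-surjective ([]-continuous 𝐈ℝ-poset)
    (λ V → borel-open (i⊥-continuous em (set V) (isOpen V)))
    (λ V → measure-resp μ _ _ (id , id))
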